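{- Suppose $k, n, \ell \in \omega$ with $\ell \geq 1$, where \[ \left\lfloor \frac{n}{\ell} \right\rfloor \geq 2^{3k+3} \qquad\text{and}\qquad n \geq \frac{ -2^{4k+7}}{\log_2\left(1-\frac{1}{(k+1)\cdot 2^{k+1}}\right)}. \] Then \[ \frac{\left|\{\mathcal{G} \in \mathbb{G}_{k+1}(n) : (\exists \mathcal{H} \in \mathbb{G}_{k}(n))\ \mathcal{G} \cong \mathcal{H}\}\right|}{\left|\mathbb{G}_{k+1}(n)\right|} \leq \left(\left(1-\frac{1}{(k+1)\cdot 2^{k+1}}\right)^{\frac{1}{2^{3k+3}}}\right)^{n} \cdot 2^{2^{3k+5}}. \]
   Context: Notation: $\omega=\{0,1,2,\dots\}$ and $[m]=\{0,1,\dots,m-1\}$; $\mathcal{P}(Z)$ is the power set of $Z$. Graphs are simple undirected graphs. For $k,n\in\omega$, a $k$-rainbow sequence on $[n]$ is a pair $S=(a,e)$ of functions $a:[n]\to[k]$ and $e:[n]\to\mathcal{P}([k])$. The graph associated with $S$ is the graph on vertex set $[n]$ in which, for all $x<y$ in $[n]$, $x$ and $y$ are adjacent if and only if $a(x)\in e(y)$. $\mathbb{G}_k(n)$ denotes the set of all (labelled) graphs on vertex set $[n]$ that are associated with some $k$-rainbow sequence on $[n]$ (the $k$-rainbow threshold graphs on $[n]$). $\cong$ denotes graph isomorphism. -}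

module Defs where

import Algebra.Definitions.RawSemiring
open import Data.Bool using (Bool; true; false)
import Data.Bool.Properties as Bool
open import Data.Fin as Fin using (Fin; zero; suc)
open import Data.Fin.Permutation using (Permutation′; permutation; _⟨$⟩ʳ_; _⟨$⟩ˡ_; inverseˡ; inverseʳ)
import Data.Fin.Properties as Fin
open import Data.Fin.Subset using (Subset; _∈_; ⊥)
open import Data.Fin.Subset.Properties using (_∈?_; ∉⊥)
open import Data.Integer as ℤ using (ℤ; +_; -[1+_])
import Data.Integer.Properties as ℤ
open import Data.List using (List; []; _∷_; length; filter; allFin; cartesianProductWith)
open import Data.List.Membership.Propositional using (find; lose) renaming (_∈_ to _∈ˡ_)
open import Data.List.Membership.Propositional.Properties
  using (∈-allFin; ∈-cartesianProductWith⁺; ∈-filter⁺)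
open import Data.List.Relation.Unary.All using (All; []; _∷_)
open import Data.List.Relation.Unary.Any as Any using (here; there)
open import Data.List.Relation.Unary.Unique.Propositional using (Unique; []; _∷_)
import Data.List.Relation.Unary.Unique.Propositional.Properties as Unique
open import Data.Nat as ℕ using (ℕ; zero; suc)
import Data.Nat.Properties as ℕ
open import Data.Product using (∃; ∃₂; _×_; _,_)
open import Data.Rational as ℚ using (ℚ; 0ℚ; 1ℚ; ½; ↥_; ↧ₙ_; _⊓_; _⊔_)
import Data.Rational.Properties as ℚ
import Data.Rational.Unnormalised as ℚᵘ
import Data.Rational.Unnormalised.Properties as ℚᵘ
open import Data.Sum using (_⊎_)
open import Data.Vec using (Vec; []; _∷_; lookup; tabulate; replicate)
open import Data.Vec.Properties using (lookup∘tabulate; lookup-replicate; ∷-injective)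
open import Function using (_⇔_; mk⇔; Equivalence)
open import Relation.Binary.PropositionalEquality using (_≡_; _≢_; refl; sym; trans; cong; cong₂; subst; subst₂)
open import Relation.Nullary using (Dec; yes; no; ¬_; contradiction)
open import Relation.Nullary.Negation using (contradiction-irr)
open import Relation.Nullary.Decidable using (map′; _×-dec_; _→-dec_)
open import Relation.Unary using (Pred; Decidable)
open import Level using (0ℓ)

open Algebra.Definitions.RawSemiring ℚ.+-*-rawSemiring using () renaming (_^_ to _^ℚ_)

------------------------------------------------------------------------
-- Finite types and cardinalities of their decidable subsets

record Finite (A : Set) : Set where
  field
    elements : List A
    complete : ∀ x → x ∈ˡ elements
    unique   : Unique elements

open Finite public

∣_∣ : ∀ {A : Set} {P : Pred A 0ℓ} → Decidable P → {{Finite A}} → ℕ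
∣ P? ∣ {{fin}} = length (filter P? (elements fin))

∃? : ∀ {A : Set} {{_ : Finite A}} {P : Pred A 0ℓ} → Decidable P → Dec (∃ P)
∃? {{fin}} P? = map′ (λ any → let x , _ , px = find any in x , px)
                     (λ (x , px) → lose (complete fin x) px)
                     (Any.any? P? (elements fin))

instance
  finBool : Finite Bool
  finBool = record
    { elements = true ∷ false ∷ []
    ; complete = λ { true → here refl ; false → there (here refl) }
    ; unique   = ((λ ()) ∷ []) ∷ [] ∷ []
    }

  finFin : ∀ {n} → Finite (Fin n)
  finFin {n} = record
    { elements = allFin n
    ; complete = ∈-allFin
    ; unique   = Unique.allFin⁺ n
    }

  finVec : ∀ {A : Set} {{_ : Finite A}} {n} → Finite (Vec A n)
  finVec {A} {{fin}} {n} = record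
    { elements = vecs n
    ; complete = vecs-complete
    ; unique   = vecs-unique n
    }
    where
    vecs : ∀ n → List (Vec A n)
    vecs zero    = [] ∷ []
    vecs (suc n) = cartesianProductWith _∷_ (elements fin) (vecs n)

    vecs-complete : ∀ {n} (v : Vec A n) → v ∈ˡ vecs n
    vecs-complete []      = here refl
    vecs-complete (x ∷ v) = ∈-cartesianProductWith⁺ _∷_ (complete fin x) (vecs-complete v)

    vecs-unique : ∀ n → Unique (vecs n)
    vecs-unique zero    = [] ∷ []
    vecs-unique (suc n) =
      Unique.cartesianProductWith⁺ _∷_ ∷-injective (unique fin) (vecs-unique n)

------------------------------------------------------------------------
-- Labelled graphs on [n]

-- The adjacency matrix is a table and the laws are irrelevant, so two graphs
-- on [n] are propositionally equal exactly when they have the same edges.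
record Graph (n : ℕ) : Set where
  constructor graph
  field
    matrix     : Vec (Vec Bool n) n

  edge : Fin n → Fin n → Bool
  edge x y = lookup (lookup matrix x) y

  field
    .symmetric   : ∀ x y → edge x y ≡ edge y x
    .irreflexive : ∀ x → edge x x ≡ false

open Graph public using (matrix; edge)

Adjacent : ∀ {n} → Graph n → Fin n → Fin n → Set
Adjacent G x y = edge G x y ≡ true

instance
  finGraph : ∀ {n} → Finite (Graph n)
  finGraph {n} = record
    { elements = graphs (elements fin)
    ; complete = λ G → graphs-complete G (complete fin (matrix G))
    ; unique   = graphs-unique (unique fin)
    }
    where
    Matrix : Set
    Matrix = Vec (Vec Bool n) n

    fin : Finite Matrix
    fin = finVec

    Laws : Matrix → Set
    Laws M = (∀ x y → lookup (lookup M x) y ≡ lookup (lookup M y) x)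
           × (∀ x → lookup (lookup M x) x ≡ false)

    laws? : Decidable Laws
    laws? M = Fin.all? (λ x → Fin.all? (λ y → lookup (lookup M x) y Bool.≟ lookup (lookup M y) x))
        ×-dec Fin.all? (λ x → lookup (lookup M x) x Bool.≟ false)

    graphs : List Matrix → List (Graph n)
    graphs []       = []
    graphs (M ∷ Ms) with laws? M
    ... | yes (s , i) = graph M s i ∷ graphs Ms
    ... | no  _       = graphs Ms

    graphs-complete : ∀ G {Ms} → matrix G ∈ˡ Ms → G ∈ˡ graphs Ms
    graphs-complete (graph M s i) {M′ ∷ Ms} M∈ with laws? M′ | M∈
    ... | yes _ | here refl = here refl
    ... | yes _ | there M∈′ = there (graphs-complete (graph M s i) M∈′)
    ... | no ¬l | here refl = contradiction-irr (s , i) ¬l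
    ... | no _  | there M∈′ = graphs-complete (graph M s i) M∈′

    graphs-fresh : ∀ M .s .i {Ms} → All (M ≢_) Ms → All (graph M s i ≢_) (graphs Ms)
    graphs-fresh M s i {[]}      []          = []
    graphs-fresh M s i {M′ ∷ Ms} (M≢ ∷ M≢Ms) with laws? M′
    ... | yes _ = (λ eq → M≢ (cong matrix eq)) ∷ graphs-fresh M s i M≢Ms
    ... | no _  = graphs-fresh M s i M≢Ms

    graphs-unique : ∀ {Ms} → Unique Ms → Unique (graphs Ms)
    graphs-unique {[]}     []          = []
    graphs-unique {M ∷ Ms} (M≢ ∷ Ms!) with laws? M
    ... | yes (s , i) = graphs-fresh M s i M≢ ∷ graphs-unique Ms!
    ... | no  _       = graphs-unique Ms!

infix 4 _≅_ _≅?_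

_≅_ : ∀ {n} → Graph n → Graph n → Set
_≅_ {n} G H = ∃ λ (π : Permutation′ n) → ∀ x y → edge G x y ≡ edge H (π ⟨$⟩ʳ x) (π ⟨$⟩ʳ y)

_≅?_ : ∀ {n} (G H : Graph n) → Dec (G ≅ H)
_≅?_ {n} G H = map′ to from
  (∃? λ f → ∃? λ g →
     Fin.all? (λ x → lookup f (lookup g x) Fin.≟ x)
     ×-dec Fin.all? (λ x → lookup g (lookup f x) Fin.≟ x)
     ×-dec Fin.all? (λ x → Fin.all? (λ y →
             edge G x y Bool.≟ edge H (lookup f x) (lookup f y))))
  where
  Iso : Vec (Fin n) n → Vec (Fin n) n → Set
  Iso f g = (∀ x → lookup f (lookup g x) ≡ x)
          × (∀ x → lookup g (lookup f x) ≡ x)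
          × (∀ x y → edge G x y ≡ edge H (lookup f x) (lookup f y))

  to : ∃₂ Iso → G ≅ H
  to (f , g , fg , gf , iso) = permutation (lookup f) (lookup g) fg gf , iso

  from : G ≅ H → ∃₂ Iso
  from (π , iso) = tabulate (π ⟨$⟩ʳ_) , tabulate (π ⟨$⟩ˡ_)
    , (λ x → trans (lookup∘tabulate _ (lookup (tabulate (π ⟨$⟩ˡ_)) x))
                   (trans (cong (π ⟨$⟩ʳ_) (lookup∘tabulate _ x)) (inverseʳ π)))
    , (λ x → trans (lookup∘tabulate _ (lookup (tabulate (π ⟨$⟩ʳ_)) x))
                   (trans (cong (π ⟨$⟩ˡ_) (lookup∘tabulate _ x)) (inverseˡ π)))
    , (λ x y → trans (iso x y) (sym (cong₂ (edge H) (lookup∘tabulate _ x) (lookup∘tabulate _ y))))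

------------------------------------------------------------------------
-- Rainbow threshold graphs

record RainbowSequence (k n : ℕ) : Set where
  constructor _,_
  field
    a : Fin n → Fin k
    e : Fin n → Subset k

AssociatedWith : ∀ {k n} → RainbowSequence k n → Graph n → Set
AssociatedWith (a , e) G = ∀ x y → x Fin.< y → Adjacent G x y ⇔ a x ∈ e y

𝔾 : ∀ k {n} → Graph n → Set
𝔾 k {n} G = ∃ λ (S : RainbowSequence k n) → AssociatedWith S G

𝔾? : ∀ k {n} → Decidable (𝔾 k {n})
𝔾? k {n} G = map′ to from
  (∃? λ a → ∃? λ e → Fin.all? λ x → Fin.all? λ y →
     (x Fin.<? y) →-dec iff? (edge G x y Bool.≟ true) (lookup a x ∈? lookup e y))
  where
  iff? : ∀ {A B : Set} → Dec A → Dec B → Dec (A ⇔ B)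
  iff? A? B? = map′ (λ (f , g) → mk⇔ f g) (λ eq → Equivalence.to eq , Equivalence.from eq)
                    ((A? →-dec B?) ×-dec (B? →-dec A?))

  Table : Vec (Fin k) n → Vec (Subset k) n → Set
  Table a e = AssociatedWith (lookup a , lookup e) G

  to : ∃₂ Table → 𝔾 k G
  to (a , e , assoc) = (lookup a , lookup e) , assoc

  from : 𝔾 k G → ∃₂ Table
  from ((a , e) , assoc) = tabulate a , tabulate e ,
    λ x y x<y → subst₂ (λ i p → Adjacent G x y ⇔ i ∈ p)
      (sym (lookup∘tabulate a x)) (sym (lookup∘tabulate e y)) (assoc x y x<y)

IsoToLower : ∀ k {n} → Graph n → Set
IsoToLower k {n} G = 𝔾 (suc k) G × ∃ λ (H : Graph n) → 𝔾 k H × G ≅ H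

isoToLower? : ∀ k {n} → Decidable (IsoToLower k {n})
isoToLower? k G = 𝔾? (suc k) G ×-dec ∃? (λ H → 𝔾? k H ×-dec G ≅? H)

edgeless : ∀ n → Graph n
edgeless n = graph (replicate n (replicate n false))
  (λ x y → trans (entry x y) (sym (entry y x))) (λ x → entry x x)
  where
  entry : ∀ x y → lookup (lookup (replicate n (replicate n false)) x) y ≡ false
  entry x y = trans (cong (λ r → lookup r y) (lookup-replicate x (replicate n false)))
                    (lookup-replicate y false)

edgeless∈𝔾 : ∀ k n → 𝔾 (suc k) (edgeless n)
edgeless∈𝔾 k n = ((λ _ → zero) , (λ _ → ⊥)) , λ x y _ →
  mk⇔ (λ adj → contradiction (trans (sym adj) (entry x y)) λ ()) (λ z∈ → contradiction z∈ ∉⊥)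
  where
  entry : ∀ x y → edge (edgeless n) x y ≡ false
  entry x y = trans (cong (λ r → lookup r y) (lookup-replicate x (replicate n false)))
                    (lookup-replicate y false)

∣𝔾∣-nonZero : ∀ k n → ℕ.NonZero ∣ 𝔾? (suc k) {n} ∣
∣𝔾∣-nonZero k n = nonEmpty
  (∈-filter⁺ (𝔾? (suc k)) (complete finGraph (edgeless n)) (edgeless∈𝔾 k n))
  where
  nonEmpty : ∀ {G : Graph n} {Gs} → G ∈ˡ Gs → ℕ.NonZero (length Gs)
  nonEmpty (here _)  = _
  nonEmpty (there _) = _

------------------------------------------------------------------------
-- Real numbers as cuts

-- A real number is presented by the rationals strictly below and strictly
-- above it. Only cuts obtained from the operations below occur; each of these
-- gives the open lower and upper rational sets of the real it denotes, so the
-- Dedekind laws (roundedness, disjointness, locatedness) are not carried along.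
record Cut : Set₁ where
  field
    Lower : ℚ → Set
    Upper : ℚ → Set

open Cut public

infix 4 _<ᶜ_ _≤ᶜ_ _≥ᶜ_

_<ᶜ_ _≤ᶜ_ _≥ᶜ_ : Cut → Cut → Set
x <ᶜ y = ∃ λ r → Upper x r × Lower y r
x ≤ᶜ y = ¬ (y <ᶜ x)
x ≥ᶜ y = y ≤ᶜ x

fromℚ : ℚ → Cut
fromℚ q = record
  { Lower = λ p → p ℚ.< q
  ; Upper = λ p → q ℚ.< p
  }

fromℕ : ℕ → ℚ
fromℕ m = + m ℚ./ 1

infixl 7 _*ᶜ_ _÷ᶜ_
infixr 8 _^ᶜ_

-- Interval arithmetic: if a < x < b and c < y < d, then x y lies between the
-- least and the greatest of the products of endpoints.
_*ᶜ_ : Cut → Cut → Cut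
x *ᶜ y = record
  { Lower = λ p → ∃₂ λ a b → ∃₂ λ c d → Bounds a b c d
                × p ℚ.< (a ℚ.* c ⊓ a ℚ.* d) ⊓ (b ℚ.* c ⊓ b ℚ.* d)
  ; Upper = λ p → ∃₂ λ a b → ∃₂ λ c d → Bounds a b c d
                × (a ℚ.* c ⊔ a ℚ.* d) ⊔ (b ℚ.* c ⊔ b ℚ.* d) ℚ.< p
  }
  where
  Bounds : ℚ → ℚ → ℚ → ℚ → Set
  Bounds a b c d = Lower x a × Upper x b × Lower y c × Upper y d

-- For x ≠ 0: if a < x < b with a and b nonzero of the same sign, then q / x
-- lies between q / a and q / b.
_÷ᶜ_ : ℚ → Cut → Cut
q ÷ᶜ x = record
  { Lower = λ p → ∃₂ λ a b → Bounds a b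
                × ∃₂ λ a≢0 b≢0 → p ℚ.< (ℚ._÷_ q a {{a≢0}}) ⊓ (ℚ._÷_ q b {{b≢0}})
  ; Upper = λ p → ∃₂ λ a b → Bounds a b
                × ∃₂ λ a≢0 b≢0 → (ℚ._÷_ q a {{a≢0}}) ⊔ (ℚ._÷_ q b {{b≢0}}) ℚ.< p
  }
  where
  Bounds : ℚ → ℚ → Set
  Bounds a b = Lower x a × Upper x b × 0ℚ ℚ.< a ℚ.* b

_^ᶜ_ : Cut → ℕ → Cut
x ^ᶜ zero  = fromℚ 1ℚ
x ^ᶜ suc n = x *ᶜ (x ^ᶜ n)

-- The nonnegative m-th root q^(1/m).
root : (m : ℕ) .{{_ : ℕ.NonZero m}} (q : ℚ) .{{_ : ℚ.NonNegative q}} → Cut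
root m q = record
  { Lower = λ p → p ℚ.< 0ℚ ⊎ p ^ℚ m ℚ.< q
  ; Upper = λ p → 0ℚ ℚ.< p × q ℚ.< p ^ℚ m
  }

2^ℤ_ : ℤ → ℚ
2^ℤ (+ m)    = fromℕ 2 ^ℚ m
2^ℤ -[1+ m ] = ½ ^ℚ suc m

-- For p = u / v with v > 0, p < log₂ q means 2^u < q^v.
log₂ : (q : ℚ) .{{_ : ℚ.Positive q}} → Cut
log₂ q = record
  { Lower = λ p → 2^ℤ (↥ p) ℚ.< q ^ℚ ↧ₙ p
  ; Upper = λ p → q ^ℚ ↧ₙ p ℚ.< 2^ℤ (↥ p)
  }

------------------------------------------------------------------------
-- The constants of the estimate

2^-nonZero : ∀ m → ℕ.NonZero (2 ℕ.^ m)
2^-nonZero m = ℕ.m^n≢0 2 m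

types-nonZero : ∀ k → ℕ.NonZero (suc k ℕ.* 2 ℕ.^ suc k)
types-nonZero k = ℕ.m*n≢0 (suc k) (2 ℕ.^ suc k) {{_}} {{2^-nonZero (suc k)}}

β : ℕ → ℚ
β k = 1ℚ ℚ.- ((+ 1 ℚ./ (suc k ℕ.* 2 ℕ.^ suc k)) {{types-nonZero k}})

1/d<1 : ∀ d .{{_ : ℕ.NonZero d}} → 1 ℕ.< d → + 1 ℚ./ d ℚ.< 1ℚ
1/d<1 (suc d) 1<d = ℚ.toℚᵘ-cancel-<
  (ℚᵘ.<-respˡ-≃ (ℚᵘ.≃-sym (ℚ.toℚᵘ-fromℚᵘ (ℚᵘ.mkℚᵘ (+ 1) d)))
    (ℚᵘ.*<* (subst₂ ℤ._<_ refl (sym (ℤ.*-identityˡ (+ suc d))) (ℤ.+<+ 1<d))))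

β-positive : ∀ k → ℚ.Positive (β k)
β-positive k = ℚ.positive
  (subst (ℚ._< β k) (ℚ.+-inverseʳ r)
    (ℚ.+-monoˡ-< (ℚ.- r) (1/d<1 d {{types-nonZero k}} 1<d)))
  where
  d = suc k ℕ.* 2 ℕ.^ suc k
  r = (+ 1 ℚ./ d) {{types-nonZero k}}

  1<d : 1 ℕ.< d
  1<d = ℕ.≤-trans (ℕ.*-monoʳ-≤ 2 (ℕ.m^n>0 2 k)) (ℕ.m≤m+n (2 ℕ.^ suc k) (k ℕ.* 2 ℕ.^ suc k))

β-nonNegative : ∀ k → ℚ.NonNegative (β k)
β-nonNegative k = ℚ.pos⇒nonNeg (β k) {{β-positive k}}

{-# OPTIONS --safe #-}

-- Let K = k + 1, so that a letter (a x , e x) of a K-rainbow sequence takes D = K 2^K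
-- values, and N = 2^(3k + 3). Some fixed word of at most N letters has a graph that is not
-- an induced subgraph of any graph isomorphic to a k-rainbow one. Cut [n] into blocks of
-- length ⌊n/N⌋. If a K-rainbow graph is isomorphic to a k-rainbow graph, then some letter of
-- that word is missing from its block in the sequence, since otherwise the word is a
-- subsequence; hence there are at most N (D − 1)^⌊n/N⌋ D^(n − ⌊n/N⌋) such graphs.
-- Conversely, sequences with suitable fixed letters at both ends are determined by their
-- graphs, whence ∣𝔾_K(n)∣ ≥ D^(n − 2K). As β = (D − 1) / D, the quotient of the two
-- counts is at most N D^(2K) β^⌊n/N⌋.
module Submission where

open import Defs
open import Data.Integer using (+_)
open import Data.Nat using (ℕ; suc; NonZero; _+_; _*_; _^_; _/_; _≥_)
import Data.Rational as ℚ

import Algebra.Definitions.RawSemiring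
import Algebra.Properties.CommutativeSemiring.Exp
open import Algebra.Bundles using (CommutativeRing)
open import Data.Bool using (Bool; true; false; _∨_)
import Data.Bool.Properties as Bool
import Data.Empty as Empty
open import Data.Fin as Fin
  using (Fin; zero; suc; toℕ; combine; punchIn; punchOut; fromℕ<; finToFun; funToFin; remQuot; _↑ˡ_; _↑ʳ_; splitAt)
open import Data.Fin.Permutation using (_⟨$⟩ʳ_)
import Data.Fin.Properties as Fin
open import Data.Fin.Subset using (Subset; _∈_; ⁅_⁆; ⊥)
open import Data.Fin.Subset.Properties using (_∈?_; x∈⁅x⁆; x∈⁅y⁆⇒x≡y; ⊆-antisym)
import Data.Integer as ℤ
import Data.Integer.Properties as ℤ
open import Data.List as List using (List; []; _∷_)
import Data.List.Extrema.Nat as Extrema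
open import Data.List.Membership.Propositional using () renaming (_∈_ to _∈ˡ_)
open import Data.List.Membership.Propositional.Properties using (∈-allFin; ∈-filter⁺; ∈-lookup)
import Data.List.Relation.Unary.All as All
import Data.List.Relation.Unary.All.Properties as All
import Data.List.Relation.Unary.Any as Any
import Data.List.Relation.Unary.Any.Properties as Any
open import Data.List.Relation.Unary.Unique.Propositional using (Unique; []; _∷_)
import Data.List.Relation.Unary.Unique.Propositional.Properties as Unique
open import Data.Nat as ℕ using (zero; _∸_; _≤_; _<_; s≤s; z≤n)
open import Data.Nat.DivMod using (m%n<n; m/n≤m; m/n*n≤m; m≡m%n+[m/n]*n)
import Data.Nat.Properties as ℕ
open import Data.Nat.Tactic.RingSolver using (solve-∀)
open import Data.Product using (∃; ∃₂; _×_; _,_; proj₁; proj₂; uncurry)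
open import Data.Product.Function.NonDependent.Propositional using (_×-↔_)
open import Data.Rational using (ℚ; 0ℚ; 1ℚ)
import Data.Rational.Properties as ℚ
open import Data.Rational.Solver using (module +-*-Solver)
import Data.Rational.Unnormalised as ℚᵘ
import Data.Rational.Unnormalised.Properties as ℚᵘ
open import Data.Sum using (_⊎_; inj₁; inj₂; [_,_]′)
open import Data.Vec using (Vec; []; _∷_; lookup; tabulate)
open import Data.Vec.Properties using (lookup∘tabulate; tabulate∘lookup; tabulate-cong; []=⇒lookup; lookup⇒[]=)
open import Function using (_∘_; _⇔_; _↔_; mk⇔; mk↔ₛ′; Equivalence; Inverse; Injection)
open import Function.Construct.Composition using (_↔-∘_; _⇔-∘_)
open import Function.Construct.Identity using (↔-id)
open import Function.Construct.Symmetry using (↔-sym; ⇔-sym)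
open import Function.Properties.Inverse using (↔⇒↣)
open import Level using (0ℓ)
open import Relation.Binary.Definitions using (tri<; tri≈; tri>)
open import Relation.Binary.PropositionalEquality
open import Relation.Nullary using (Dec; Reflects; does; proof; invert; ¬_; yes; no; contradiction)
open import Relation.Nullary.Decidable
  using (dec-true; dec-false; decidable-stable; recompute; ¬?; _×-dec_)
open import Relation.Unary using (Pred; Decidable)

open Algebra.Definitions.RawSemiring ℚ.+-*-rawSemiring using () renaming (_^_ to _^ℚ_)
open Algebra.Properties.CommutativeSemiring.Exp (CommutativeRing.commutativeSemiring ℚ.+-*-commutativeRing)
  using () renaming (^-distrib-* to ^ℚ-distrib-*)

-- Graphs that need more than k colours

edge-sym : ∀ {n} (G : Graph n) x y → edge G x y ≡ edge G y x
edge-sym (graph _ s _) x y = recompute (_ Bool.≟ _) (s x y)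

edge-irrefl : ∀ {n} (G : Graph n) x → edge G x x ≡ false
edge-irrefl (graph _ _ i) x = recompute (_ Bool.≟ _) (i x)

abstract
  minimal : ∀ {m} (f : Fin (suc m) → ℕ) → ∃ λ i → ∀ j → f i ≤ f j
  minimal f = Extrema.argmin f zero (List.allFin _) ,
    λ j → All.lookup (Extrema.f[argmin]≤f[xs] {f = f} zero (List.allFin _)) (∈-allFin j)

  maximal : ∀ {m} (f : Fin (suc m) → ℕ) → ∃ λ i → ∀ j → f j ≤ f i
  maximal f = Extrema.argmax f zero (List.allFin _) ,
    λ j → All.lookup (Extrema.f[xs]≤f[argmax] {f = f} zero (List.allFin _)) (∈-allFin j)

-- The graph of the sequence that repeats the letters (i , {0, …, i − 1}) for i = 0, …, k
-- in this order, r times over; v s i is the vertex of colour i in round s.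
record Staircase (k r : ℕ) {n} (G : Graph n) : Set where
  field
    v        : Fin r → Fin (suc k) → Fin n
    disjoint : ∀ {s t i j} → s ≢ t → v s i ≢ v t j
    up       : ∀ {s t i j} → s Fin.≤ t → i Fin.< j → edge G (v s i) (v t j) ≡ true
    down     : ∀ {s t i j} → s Fin.< t → j Fin.≤ i → edge G (v s i) (v t j) ≡ false

-- At a cut of the ranking, the vertices before it have at most k distinct
-- neighbourhoods among the vertices after it.
record Layout (k : ℕ) {n} (G : Graph n) : Set where
  field
    rank           : Fin n → ℕ
    rank-injective : ∀ {x y} → rank x ≡ rank y → x ≡ y
    colour         : Fin n → Fin k
    twins          : ∀ {x x′ y} → rank x < rank y → rank x′ < rank y →
                     colour x ≡ colour x′ → edge G x y ≡ edge G x′ y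

-- Both edges run from an earlier vertex into `y`, so each is decided by whether the common colour
-- lies in the subset at `y`.
same-colour : ∀ {k n} {S : RainbowSequence k n} {H : Graph n} → AssociatedWith S H →
              ∀ {x x′ y} → x Fin.< y → x′ Fin.< y →
              RainbowSequence.a S x ≡ RainbowSequence.a S x′ → edge H x y ≡ edge H x′ y
same-colour {H = H} assoc {x} {x′} {y} x<y x′<y eq = Bool.⇔→≡
  (⇔-sym (assoc x′ y x′<y) ⇔-∘ subst (λ c → Adjacent H x y ⇔ c ∈ _) eq (assoc x y x<y))

-- The ranking is the order of the rainbow sequence of `H`, pulled back along the isomorphism; the
-- colours are pulled back in the same way.
layout : ∀ {k n} {G H : Graph n} → 𝔾 k H → G ≅ H → Layout k G
layout {H = H} (S , assoc) (π , iso) = record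
  { rank           = λ x → toℕ (π ⟨$⟩ʳ x)
  ; rank-injective = λ eq → Injection.injective (↔⇒↣ π) (Fin.toℕ-injective eq)
  ; colour         = λ x → RainbowSequence.a S (π ⟨$⟩ʳ x)
  ; twins          = λ {x} {x′} {y} x<y x′<y eq →
      trans (iso x y) (trans (same-colour {H = H} assoc x<y x′<y eq) (sym (iso x′ y)))
  }

-- Cut the ranking where the first round s₀ is complete. If some round lies wholly after
-- the cut, it tells the k + 1 vertices of s₀ apart. Otherwise each of the m other rounds has
-- vertices on both sides, of colours i before and j after the cut say; two rounds agree in
-- i, j and the layout colour of the former vertex, yet the latter ones tell them apart.
module _ {k m n : ℕ} {G : Graph n} (many : suc k * suc k * k < m)
         (staircase : Staircase k (suc m) G) (lay : Layout k G) where
  open Staircase staircase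
  open Layout lay

  private
    separated : ∀ {x x′ y} → rank x < rank y → rank x′ < rank y → colour x ≡ colour x′ →
                edge G x y ≡ true → edge G x′ y ≢ false
    separated x<y x′<y eq t f = contradiction (trans (sym t) (trans (twins x<y x′<y eq) f)) λ ()

    up′ : ∀ {s t i j} → t Fin.≤ s → j Fin.< i → edge G (v s i) (v t j) ≡ true
    up′ {s} {t} {i} {j} t≤s j<i = trans (edge-sym G (v s i) (v t j)) (up t≤s j<i)

    down′ : ∀ {s t i j} → t Fin.< s → i Fin.≤ j → edge G (v s i) (v t j) ≡ false
    down′ {s} {t} {i} {j} t<s i≤j = trans (edge-sym G (v s i) (v t j)) (down t<s i≤j)

    last : ∀ s → ∃ λ i → ∀ j → rank (v s j) ≤ rank (v s i)
    last s = maximal (rank ∘ v s)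

    first : ∃ λ s → ∀ t → rank (v s (proj₁ (last s))) ≤ rank (v t (proj₁ (last t)))
    first = minimal λ s → rank (v s (proj₁ (last s)))

    s₀ : Fin (suc m)
    s₀ = proj₁ first

    cut : ℕ
    cut = rank (v s₀ (proj₁ (last s₀)))

    before : ∀ i → rank (v s₀ i) ≤ cut
    before = proj₂ (last s₀)

    -- The last vertex of round `s` works: minimality of `s₀` keeps it from ranking below the cut,
    -- and a tie would put one vertex into two rounds.
    some-after : ∀ {s} → s ≢ s₀ → ∃ λ j → cut < rank (v s j)
    some-after {s} s≢s₀ = proj₁ (last s) , ℕ.≤∧≢⇒< (proj₂ first s)
      (λ eq → disjoint s≢s₀ (rank-injective (sym eq)))

    -- Two of the `k + 1` vertices of `s₀` share a layout colour, say those of indices `i < j`. The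
    -- vertex of index `j` in round `t`, or of index `i` when `t` precedes `s₀`, is adjacent to
    -- exactly one of the two, yet it ranks after both.
    ¬all-after : ∀ {t} → t ≢ s₀ → ¬ (∀ i → cut < rank (v t i))
    ¬all-after {t} t≢s₀ after
      with i , j , i<j , eq ← Fin.pigeonhole (ℕ.n<1+n k) (λ i → colour (v s₀ i))
         | Fin.<-cmp s₀ t
    ... | tri< s₀<t _ _ = separated (earlier i) (earlier j) eq (up (ℕ.<⇒≤ s₀<t) i<j) (down s₀<t ℕ.≤-refl)
      where
      earlier : ∀ i → rank (v s₀ i) < rank (v t j)
      earlier i = ℕ.≤-<-trans (before i) (after j)
    ... | tri≈ _ s₀≡t _ = t≢s₀ (sym s₀≡t)
    ... | tri> _ _ t<s₀ = separated (earlier j) (earlier i) (sym eq) (up′ (ℕ.<⇒≤ t<s₀) i<j) (down′ t<s₀ ℕ.≤-refl)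
      where
      earlier : ∀ j → rank (v s₀ j) < rank (v t i)
      earlier j = ℕ.≤-<-trans (before j) (after i)

    some-before : ∀ {s} → s ≢ s₀ → ∃ λ i → rank (v s i) ≤ cut
    some-before {s} s≢s₀ with Fin.any? (λ i → rank (v s i) ℕ.≤? cut)
    ... | yes found = found
    ... | no  none  = contradiction (λ i → ℕ.≰⇒> (λ ≤cut → none (i , ≤cut))) (¬all-after s≢s₀)

    other : Fin m → Fin (suc m)
    other = punchIn s₀

    other≢s₀ : ∀ r → other r ≢ s₀
    other≢s₀ = Fin.punchInᵢ≢i s₀

    other-mono-< : ∀ {r r′} → r Fin.< r′ → other r Fin.< other r′
    other-mono-< {r} {r′} r<r′ = Fin.≤∧≢⇒< (Fin.punchIn-mono-≤ s₀ r r′ (ℕ.<⇒≤ r<r′))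
                                          (λ eq → Fin.<⇒≢ r<r′ (Fin.punchIn-injective s₀ r r′ eq))

    i* j* : Fin m → Fin (suc k)
    i* r = proj₁ (some-before (other≢s₀ r))
    j* r = proj₁ (some-after (other≢s₀ r))

    before* : ∀ r → rank (v (other r) (i* r)) ≤ cut
    before* r = proj₂ (some-before (other≢s₀ r))

    after* : ∀ r → cut < rank (v (other r) (j* r))
    after* r = proj₂ (some-after (other≢s₀ r))

    -- The cut rules out `i ≡ j`. The later-ranked vertex of round `s` (if `i < j`) or of round `t`
    -- (if `j < i`) is adjacent to the vertex of index `i` in its own round but not to the one in
    -- the other round.
    clash : ∀ {s t i j} → s Fin.< t → colour (v s i) ≡ colour (v t i) →
            rank (v s i) ≤ cut → rank (v t i) ≤ cut →
            cut < rank (v s j) → cut < rank (v t j) → Empty.⊥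
    clash {s} {t} {i} {j} s<t eq si ti sj tj with Fin.<-cmp i j
    ... | tri< i<j _ _  = separated (ℕ.≤-<-trans si sj) (ℕ.≤-<-trans ti sj) eq (up (ℕ.≤-refl {toℕ s}) i<j) (down′ s<t (ℕ.<⇒≤ i<j))
    ... | tri≈ _ refl _ = ℕ.<⇒≱ sj si
    ... | tri> _ _ j<i  = separated (ℕ.≤-<-trans ti tj) (ℕ.≤-<-trans si tj) (sym eq) (up′ (ℕ.≤-refl {toℕ t}) j<i) (down s<t (ℕ.<⇒≤ j<i))

    -- The data on which two rounds have to agree for `clash`; by `many` there are fewer values than
    -- rounds other than `s₀`.
    shape : Fin m → Fin (suc k * suc k * k)
    shape r = combine (combine (i* r) (j* r)) (colour (v (other r) (i* r)))

    shape-injective : ∀ {r r′} → shape r ≡ shape r′ →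
                      i* r ≡ i* r′ × j* r ≡ j* r′ ×
                      colour (v (other r) (i* r)) ≡ colour (v (other r′) (i* r′))
    shape-injective {r} {r′} eq
      with ij≡ , c≡ ← Fin.combine-injective (combine (i* r) (j* r)) _ (combine (i* r′) (j* r′)) _ eq
      with i≡ , j≡ ← Fin.combine-injective (i* r) (j* r) (i* r′) (j* r′) ij≡
      = i≡ , j≡ , c≡

  ¬staircase-layout : Empty.⊥
  ¬staircase-layout
    with r , r′ , r<r′ , eq ← Fin.pigeonhole many shape
    with i≡ , j≡ , c≡ ← shape-injective eq
    = clash (other-mono-< r<r′)
        (trans c≡ (cong (λ i → colour (v (other r′) i)) (sym i≡)))
        (before* r) (subst (λ i → rank (v (other r′) i) ≤ cut) (sym i≡) (before* r′))
        (after* r) (subst (λ j → cut < rank (v (other r′) j)) (sym j≡) (after* r′))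

-- Cardinalities and codes

lookup-injective : ∀ {A : Set} {xs : List A} → Unique xs →
                   ∀ {i j} → List.lookup xs i ≡ List.lookup xs j → i ≡ j
lookup-injective (_  ∷ _)   {zero}  {zero}  _  = refl
lookup-injective (x∉ ∷ _)   {zero}  {suc j} eq = contradiction eq (All.lookup x∉ (∈-lookup j))
lookup-injective (x∉ ∷ _)   {suc i} {zero}  eq = contradiction (sym eq) (All.lookup x∉ (∈-lookup i))
lookup-injective (_  ∷ xs!) {suc i} {suc j} eq = cong suc (lookup-injective xs! eq)

module _ {A : Set} {{fin : Finite A}} {P : Pred A 0ℓ} (P? : Decidable P) where

  -- The code may depend on the proof of `P x`, as a code built from a chosen rainbow sequence does:
  -- the filtered list supplies one proof for each of its elements.
  ∣∣-≤ : ∀ {m} (f : ∀ {x} → P x → Fin m) →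
         (∀ {x y} (px : P x) (py : P y) → f px ≡ f py → x ≡ y) → ∣ P? ∣ ≤ m
  ∣∣-≤ f f-injective = Fin.injective⇒≤ {f = λ i → f (holds i)} λ {i} {j} eq →
    lookup-injective (Unique.filter⁺ P? (unique fin)) (f-injective (holds i) (holds j) eq)
    where
    holds : ∀ i → P (List.lookup (List.filter P? (elements fin)) i)
    holds i = All.lookup (All.all-filter P? (elements fin)) (∈-lookup i)

  ≤-∣∣ : ∀ {m} (f : Fin m → A) → (∀ i → P (f i)) →
         (∀ {i j} → f i ≡ f j → i ≡ j) → m ≤ ∣ P? ∣
  ≤-∣∣ f Pf f-injective = Fin.injective⇒≤ {f = λ i → Any.index (f∈ i)} λ {i} {j} eq → f-injective
    (trans (Any.lookup-index (f∈ i))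
      (trans (cong (List.lookup (List.filter P? (elements fin))) eq) (sym (Any.lookup-index (f∈ j)))))
    where
    f∈ : ∀ i → f i ∈ˡ List.filter P? (elements fin)
    f∈ i = ∈-filter⁺ P? (complete fin (f i)) (Pf i)

funToFin-injective : ∀ {m n} {f g : Fin m → Fin n} → funToFin f ≡ funToFin g → f ≗ g
funToFin-injective {f = f} {g} eq i =
  trans (sym (Fin.finToFun-funToFin f i)) (trans (cong (λ c → finToFun c i) eq) (Fin.finToFun-funToFin g i))

finToFun-injective : ∀ {m n} {c c′ : Fin (n ^ m)} → finToFun {n} {m} c ≗ finToFun c′ → c ≡ c′
finToFun-injective {zero}  {n} {zero} {zero} _  = refl
finToFun-injective {suc m} {n} {c} {c′} eq = begin
  c                                        ≡⟨ Fin.combine-remQuot {n} (n ^ m) c ⟨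
  uncurry combine (remQuot {n} (n ^ m) c)  ≡⟨ cong₂ combine (eq zero) (finToFun-injective {m} (eq ∘ suc)) ⟩
  uncurry combine (remQuot {n} (n ^ m) c′) ≡⟨ Fin.combine-remQuot {n} (n ^ m) c′ ⟩
  c′                                       ∎
  where open ≡-Reasoning

-- A word of length n is determined by its block of length q at offset o and by
-- its other letters; the block has d possible letters when one letter is forbidden.
module _ {n : ℕ} (q o : ℕ) (fits : o + q ≤ n) where

  within : Fin q → Fin n
  within r = fromℕ< {o + toℕ r} (ℕ.≤-trans (ℕ.+-monoʳ-< o (Fin.toℕ<n r)) fits)

  toℕ-within : ∀ r → toℕ (within r) ≡ o + toℕ r
  toℕ-within r = Fin.toℕ-fromℕ< _

  without : Fin (n ∸ q) → Fin n
  without i with toℕ i ℕ.<? o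
  ... | yes _ = fromℕ< (ℕ.<-≤-trans (Fin.toℕ<n i) (ℕ.m∸n≤m n q))
  ... | no  _ = fromℕ< (ℕ.m≤o∸n⇒m+n≤o (suc (toℕ i)) (ℕ.m+n≤o⇒n≤o o fits) (Fin.toℕ<n i))

  toℕ-without-< : ∀ i → toℕ i < o → toℕ (without i) ≡ toℕ i
  toℕ-without-< i i<o with toℕ i ℕ.<? o
  ... | yes _  = Fin.toℕ-fromℕ< _
  ... | no i≮o = contradiction i<o i≮o

  toℕ-without-≥ : ∀ i → o ≤ toℕ i → toℕ (without i) ≡ toℕ i + q
  toℕ-without-≥ i o≤i with toℕ i ℕ.<? o
  ... | yes i<o = contradiction o≤i (ℕ.<⇒≱ i<o)
  ... | no  _   = Fin.toℕ-fromℕ< _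

  within-or-without : ∀ x → (∃ λ r → within r ≡ x) ⊎ (∃ λ i → without i ≡ x)
  within-or-without x with toℕ x ℕ.<? o | toℕ x ℕ.<? o + q
  ... | yes x<o | _ = inj₂ (fromℕ< x<n∸q , Fin.toℕ-injective
          (trans (toℕ-without-< _ (subst (_< o) (sym (Fin.toℕ-fromℕ< x<n∸q)) x<o)) (Fin.toℕ-fromℕ< x<n∸q)))
    where
    x<n∸q : toℕ x < n ∸ q
    x<n∸q = ℕ.m+n≤o⇒m≤o∸n (suc (toℕ x)) (ℕ.≤-trans (ℕ.+-monoˡ-≤ q x<o) fits)
  ... | no x≮o | yes x<o+q = inj₁ (fromℕ< x∸o<q , Fin.toℕ-injective (begin
          toℕ (within (fromℕ< x∸o<q)) ≡⟨ toℕ-within _ ⟩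
          o + toℕ (fromℕ< x∸o<q)      ≡⟨ cong (_+_ o) (Fin.toℕ-fromℕ< x∸o<q) ⟩
          o + (toℕ x ∸ o)             ≡⟨ ℕ.m+[n∸m]≡n (ℕ.≮⇒≥ x≮o) ⟩
          toℕ x                       ∎))
    where
    open ≡-Reasoning
    x∸o<q : toℕ x ∸ o < q
    x∸o<q = subst (toℕ x ∸ o <_) (ℕ.m+n∸m≡n o q) (ℕ.∸-monoˡ-< x<o+q (ℕ.≮⇒≥ x≮o))
  ... | no _ | no x≮o+q = inj₂ (fromℕ< x∸q<n∸q , Fin.toℕ-injective (begin
          toℕ (without (fromℕ< x∸q<n∸q)) ≡⟨ toℕ-without-≥ _ (subst (o ≤_) (sym (Fin.toℕ-fromℕ< x∸q<n∸q)) (ℕ.m+n≤o⇒m≤o∸n o (ℕ.≮⇒≥ x≮o+q))) ⟩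
          toℕ (fromℕ< x∸q<n∸q) + q       ≡⟨ cong (_+ q) (Fin.toℕ-fromℕ< x∸q<n∸q) ⟩
          toℕ x ∸ q + q                  ≡⟨ ℕ.m∸n+n≡m q≤x ⟩
          toℕ x                          ∎))
    where
    open ≡-Reasoning
    q≤x : q ≤ toℕ x
    q≤x = ℕ.m+n≤o⇒n≤o o (ℕ.≮⇒≥ x≮o+q)
    x∸q<n∸q : toℕ x ∸ q < n ∸ q
    x∸q<n∸q = ℕ.∸-monoˡ-< (Fin.toℕ<n x) q≤x

  module _ {d : ℕ} (t : Fin (suc d)) where

    Avoids : (Fin n → Fin (suc d)) → Set
    Avoids w = ∀ r → t ≢ w (within r)

    code : ∀ w → Avoids w → Fin (d ^ q * suc d ^ (n ∸ q))
    code w t∉ = combine (funToFin λ r → punchOut (t∉ r)) (funToFin (w ∘ without))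

    code-injective : ∀ {w w′} (t∉ : Avoids w) (t∉′ : Avoids w′) → code w t∉ ≡ code w′ t∉′ → w ≗ w′
    code-injective {w} {w′} t∉ t∉′ eq x
      with within≡ , without≡ ← Fin.combine-injective (funToFin λ r → punchOut (t∉ r)) _
                                                      (funToFin λ r → punchOut (t∉′ r)) _ eq
      with within-or-without x
    ... | inj₁ (r , refl) = Fin.punchOut-injective (t∉ r) (t∉′ r) (funToFin-injective within≡ r)
    ... | inj₂ (i , refl) = funToFin-injective {f = w ∘ without} without≡ i

-- Sequences and their graphs

does⇔ : ∀ {A : Set} (A? : Dec A) → does A? ≡ true ⇔ A
does⇔ A? = mk⇔ (λ eq → invert (subst (Reflects _) eq (proof A?))) (dec-true A?)

graph-ext : ∀ {n} {G H : Graph n} → (∀ x y → edge G x y ≡ edge H x y) → G ≡ H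
graph-ext {G = G} {H} eq = matrix-injective {G = G} {H} (vec-ext (λ x → vec-ext (eq x)))
  where
  vec-ext : ∀ {A : Set} {n} {u v : Vec A n} → lookup u ≗ lookup v → u ≡ v
  vec-ext {u = u} {v} eq = trans (sym (tabulate∘lookup u)) (trans (tabulate-cong eq) (tabulate∘lookup v))

  matrix-injective : ∀ {n} {G H : Graph n} → matrix G ≡ matrix H → G ≡ H
  matrix-injective {G = graph M _ _} {graph .M _ _} refl = refl

module _ {k n : ℕ} where
  open RainbowSequence

  -- The sequence decides the pairs with `x < y`; symmetry and irreflexivity settle the others.
  associated-unique : ∀ {S S′ : RainbowSequence k n} {G G′} → AssociatedWith S G → AssociatedWith S′ G′ →
                      a S ≗ a S′ → e S ≗ e S′ → G ≡ G′
  associated-unique {S} {S′} {G} {G′} assoc assoc′ a≗ e≗ = graph-ext eq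
    where
    eq< : ∀ {x y} → x Fin.< y → edge G x y ≡ edge G′ x y
    eq< {x} {y} x<y = Bool.⇔→≡ (⇔-sym (assoc′ x y x<y)
      ⇔-∘ subst₂ (λ c p → Adjacent G x y ⇔ c ∈ p) (a≗ x) (e≗ y) (assoc x y x<y))

    eq : ∀ x y → edge G x y ≡ edge G′ x y
    eq x y with Fin.<-cmp x y
    ... | tri< x<y _ _  = eq< x<y
    ... | tri≈ _ refl _ = trans (edge-irrefl G x) (sym (edge-irrefl G′ x))
    ... | tri> _ _ y<x  = trans (edge-sym G x y) (trans (eq< y<x) (edge-sym G′ y x))

  module _ (S : RainbowSequence k n) where
    private
      arc? : ∀ x y → Dec (x Fin.< y × a S x ∈ e S y)
      arc? x y = (x Fin.<? y) ×-dec (a S x ∈? e S y)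

      -- A sequence decides adjacency in one order only. The disjunction makes the table symmetric,
      -- and at most one disjunct can hold.
      adjacency : Fin n → Fin n → Bool
      adjacency x y = does (arc? x y) ∨ does (arc? y x)

      table : Vec (Vec Bool n) n
      table = tabulate λ x → tabulate (adjacency x)

      entry : ∀ x y → lookup (lookup table x) y ≡ adjacency x y
      entry x y = trans (cong (λ row → lookup row y) (lookup∘tabulate _ x)) (lookup∘tabulate _ y)

    abstract
      graphOf : Graph n
      graphOf = graph table
        (λ x y → trans (entry x y) (trans (Bool.∨-comm (does (arc? x y)) _) (sym (entry y x))))
        (λ x → trans (entry x x) (cong₂ _∨_ (dec-false (arc? x x) (ℕ.<-irrefl refl ∘ proj₁))
                                            (dec-false (arc? x x) (ℕ.<-irrefl refl ∘ proj₁))))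

      graphOf-associated : AssociatedWith S graphOf
      graphOf-associated x y x<y = mk⇔ proj₂ (x<y ,_) ⇔-∘ (does⇔ (arc? x y) ⇔-∘
        mk⇔ (trans (sym edge≡)) (trans edge≡))
        where
        edge≡ : edge graphOf x y ≡ does (arc? x y)
        edge≡ = trans (entry x y)
          (trans (cong (does (arc? x y) ∨_) (dec-false (arc? y x) (ℕ.<-asym x<y ∘ proj₁))) (Bool.∨-identityʳ _))

Letter : ℕ → Set
Letter k = Fin (suc k) × Subset (suc k)

subset↔ : ∀ k → Fin (2 ^ k) ↔ Subset k
subset↔ zero    = mk↔ₛ′ (λ _ → []) (λ _ → zero) (λ { [] → refl }) (λ { zero → refl })
subset↔ (suc k) = mk↔ₛ′ {A = Bool × Subset k} (λ (b , p) → b ∷ p) (λ { (b ∷ p) → b , p }) (λ { (_ ∷ _) → refl }) (λ _ → refl)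
              ↔-∘ ((Fin.2↔Bool ×-↔ subset↔ k) ↔-∘ Fin.*↔×)

-- The number `D` of the overview.
letters : ℕ → ℕ
letters k = suc k * 2 ^ suc k

letter↔ : ∀ k → Fin (letters k) ↔ Letter k
letter↔ k = (↔-id _ ×-↔ subset↔ (suc k)) ↔-∘ Fin.*↔×

-- The number of (k + 1)-rainbow graphs

-- Behind the initial vertices of colours 0, …, k and in front of final vertices
-- with subsets {0}, …, {k}, the graph determines the letters.
module _ {k D : ℕ} (letter↔ : Fin D ↔ Letter k) (m : ℕ) where
  private
    K size : ℕ
    K    = suc k
    size = K + (m + K)

    front back : Fin K → Fin size
    front i = i ↑ˡ (m + K)
    back  i = K ↑ʳ (m ↑ʳ i)

    middle : Fin m → Fin size
    middle j = K ↑ʳ (j ↑ˡ K)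

    front<middle : ∀ i j → front i Fin.< middle j
    front<middle i j = begin-strict
      toℕ (front i)       ≡⟨ Fin.toℕ-↑ˡ i (m + K) ⟩
      toℕ i               <⟨ Fin.toℕ<n i ⟩
      K                   ≤⟨ ℕ.m≤m+n K _ ⟩
      K + toℕ (j ↑ˡ K)    ≡⟨ Fin.toℕ-↑ʳ K (j ↑ˡ K) ⟨
      toℕ (middle j)      ∎
      where open ℕ.≤-Reasoning

    middle<back : ∀ j i → middle j Fin.< back i
    middle<back j i = begin-strict
      toℕ (middle j)       ≡⟨ Fin.toℕ-↑ʳ K (j ↑ˡ K) ⟩
      K + toℕ (j ↑ˡ K)     ≡⟨ cong (_+_ K) (Fin.toℕ-↑ˡ j K) ⟩
      K + toℕ j            <⟨ ℕ.+-monoʳ-< K (ℕ.<-≤-trans (Fin.toℕ<n j) (ℕ.m≤m+n m (toℕ i))) ⟩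
      K + (m + toℕ i)      ≡⟨ cong (_+_ K) (Fin.toℕ-↑ʳ m i) ⟨
      K + toℕ (m ↑ʳ i)     ≡⟨ Fin.toℕ-↑ʳ K (m ↑ʳ i) ⟨
      toℕ (back i)         ∎
      where open ℕ.≤-Reasoning

    -- The empty subsets in front and the colours zero at the back are mere fillers: decoding reads
    -- only the colours in front and the subsets at the back.
    word : (Fin m → Letter k) → Fin size → Letter k
    word u x = [ (λ i → i , ⊥) , (λ y → [ u , (λ i → zero , ⁅ i ⁆) ]′ (splitAt m y)) ]′ (splitAt K x)

    word-front : ∀ u i → word u (front i) ≡ (i , ⊥)
    word-front u i rewrite Fin.splitAt-↑ˡ K i (m + K) = refl

    word-middle : ∀ u j → word u (middle j) ≡ u j
    word-middle u j rewrite Fin.splitAt-↑ʳ K (m + K) (j ↑ˡ K) | Fin.splitAt-↑ˡ m j K = refl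

    word-back : ∀ u i → word u (back i) ≡ (zero , ⁅ i ⁆)
    word-back u i rewrite Fin.splitAt-↑ʳ K (m + K) (m ↑ʳ i) | Fin.splitAt-↑ʳ m K i = refl

    framed : (Fin m → Letter k) → Graph size
    framed u = graphOf ((proj₁ ∘ word u) , (proj₂ ∘ word u))

    framed-associated : ∀ u x y {l l′} → x Fin.< y → word u x ≡ l → word u y ≡ l′ →
                        Adjacent (framed u) x y ⇔ proj₁ l ∈ proj₂ l′
    framed-associated u x y x<y refl refl =
      graphOf-associated ((proj₁ ∘ word u) , (proj₂ ∘ word u)) x y x<y

    ∈-letter : ∀ u i j → Adjacent (framed u) (front i) (middle j) ⇔ i ∈ proj₂ (u j)
    ∈-letter u i j = framed-associated u (front i) (middle j) (front<middle i j) (word-front u i) (word-middle u j)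

    letter-∈ : ∀ u j i → Adjacent (framed u) (middle j) (back i) ⇔ proj₁ (u j) ∈ ⁅ i ⁆
    letter-∈ u j i = framed-associated u (middle j) (back i) (middle<back j i) (word-middle u j) (word-back u i)

    transfer : ∀ {u u′} {P Q : Set} x y → framed u ≡ framed u′ →
               Adjacent (framed u) x y ⇔ P → Adjacent (framed u′) x y ⇔ Q → P ⇔ Q
    transfer {P = P} x y eq p q = q ⇔-∘ subst (λ H → P ⇔ Adjacent H x y) eq (⇔-sym p)

    framed-injective : ∀ u u′ → framed u ≡ framed u′ → u ≗ u′
    framed-injective u u′ eq j = cong₂ _,_
      -- Under `u′` the middle vertex `j` is joined to the final vertex with subset `⁅ a′ ⁆`. The
      -- common graph carries this edge over to `u`, which forces the colour of `u j` to be `a′`.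
      (x∈⁅y⁆⇒x≡y a′ (Equivalence.from
        (transfer (middle j) (back a′) eq (letter-∈ u j a′) (letter-∈ u′ j a′)) (x∈⁅x⁆ a′)))
      -- The edges from the initial vertices, one of each colour, spell out the subset.
      (⊆-antisym (λ {i} → Equivalence.to (same-∈ i)) (λ {i} → Equivalence.from (same-∈ i)))
      where
      a′ : Fin K
      a′ = proj₁ (u′ j)

      same-∈ : ∀ i → i ∈ proj₂ (u j) ⇔ i ∈ proj₂ (u′ j)
      same-∈ i = transfer (front i) (middle j) eq (∈-letter u i j) (∈-letter u′ i j)

    framings : ∀ {n} → suc k + (m + suc k) ≡ n →
               ∃ λ (f : Fin (D ^ m) → Graph n) → (∀ c → 𝔾 (suc k) (f c)) × (∀ {c c′} → f c ≡ f c′ → c ≡ c′)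
    framings refl = framed ∘ spell
      , (λ c → ((proj₁ ∘ word (spell c)) , (proj₂ ∘ word (spell c))) , graphOf-associated _)
      , λ {c} {c′} eq → finToFun-injective {m} λ j →
          Injection.injective (↔⇒↣ letter↔) (framed-injective (spell c) (spell c′) eq j)
      where
      spell : Fin (D ^ m) → Fin m → Letter k
      spell c = Inverse.to letter↔ ∘ finToFun c

  ^≤∣𝔾∣ : ∀ {n} → suc k + (m + suc k) ≡ n → D ^ m ≤ ∣ 𝔾? (suc k) {n} ∣
  ^≤∣𝔾∣ eq with f , f∈𝔾 , f-injective ← framings eq = ≤-∣∣ (𝔾? (suc k)) f f∈𝔾 f-injective

-- The number of those isomorphic to k-rainbow graphs

below : ∀ {k} → Fin k → Subset k
below i = tabulate λ j → does (j Fin.<? i)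

∈-below : ∀ {k} {i j : Fin k} → j ∈ below i ⇔ j Fin.< i
∈-below {i = i} {j} = does⇔ (j Fin.<? i) ⇔-∘ (mk⇔ (trans (sym entry)) (trans entry)
    ⇔-∘ mk⇔ []=⇒lookup (lookup⇒[]= j (below i)))
  where
  entry : lookup (below i) j ≡ does (j Fin.<? i)
  entry = lookup∘tabulate (λ j → does (j Fin.<? i)) j

module _ {k d : ℕ} (letter↔ : Fin (suc d) ↔ Letter k) {m n q : ℕ}
         (many : suc k * suc k * k < m) (fits : suc m * suc k * q ≤ n) where
  private
    K blocks : ℕ
    K      = suc k
    blocks = suc m * K

    encode : Letter k → Fin (suc d)
    encode = Inverse.from letter↔

    encode-injective : ∀ {l l′} → encode l ≡ encode l′ → l ≡ l′
    encode-injective = Injection.injective (↔⇒↣ (↔-sym letter↔))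

    offset : Fin blocks → ℕ
    offset b = toℕ b * q

    next : ∀ {b : Fin blocks} {o} → toℕ b < o → offset b + q ≤ o * q
    next {b} b<o = ℕ.≤-trans (ℕ.≤-reflexive (ℕ.+-comm (offset b) q)) (ℕ.*-monoˡ-≤ q b<o)

    block-fits : ∀ b → offset b + q ≤ n
    block-fits b = ℕ.≤-trans (next {b} (Fin.toℕ<n b)) fits

    position : Fin blocks → Fin q → Fin n
    position b = within q (offset b) (block-fits b)

    position-mono : ∀ {b b′ r r′} → b Fin.< b′ → position b r Fin.< position b′ r′
    position-mono {b} {b′} {r} {r′} b<b′ = begin-strict
      toℕ (position b r)   ≡⟨ toℕ-within q (offset b) (block-fits b) r ⟩
      offset b + toℕ r     <⟨ ℕ.+-monoʳ-< (offset b) (Fin.toℕ<n r) ⟩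
      offset b + q         ≤⟨ next {b} b<b′ ⟩
      offset b′            ≤⟨ ℕ.m≤m+n (offset b′) _ ⟩
      offset b′ + toℕ r′   ≡⟨ toℕ-within q (offset b′) (block-fits b′) r′ ⟨
      toℕ (position b′ r′) ∎
      where open ℕ.≤-Reasoning

    step : Fin K → Letter k
    step i = i , below i

    -- The staircase word with `suc m` rounds, one letter per block: block `combine s i` asks for
    -- the letter of colour `i` in round `s`.
    target : Fin blocks → Fin (suc d)
    target b = encode (step (proj₂ (remQuot {suc m} K b)))

    Avoiding : Fin blocks → (Fin n → Fin (suc d)) → Set
    Avoiding b = Avoids q (offset b) (block-fits b) (target b)

    module _ {G : Graph n} (G∈𝔾 : 𝔾 K G) where
      open RainbowSequence (proj₁ G∈𝔾)

      letter : Fin n → Letter k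
      letter x = a x , e x

      spelled : Fin n → Fin (suc d)
      spelled = encode ∘ letter

      avoids? : Decidable λ b → Avoiding b spelled
      avoids? b = Fin.all? λ r → ¬? (target b Fin.≟ spelled (position b r))

      -- One occurrence of the target is picked from each block. Blocks follow one another in the
      -- order of the word, so the picked vertices form it as a subsequence and an earlier vertex of
      -- colour `i` is adjacent to a later one of colour `j` exactly when `i < j`.
      staircase : (∀ b → ∃ λ r → target b ≡ spelled (position b r)) → Staircase k (suc m) G
      staircase hits = record
        { v        = v
        ; disjoint = disjoint
        ; up       = λ {s} {t} s≤t i<j → Equivalence.from (adjacent {s} {t} (earlier s≤t i<j)) i<j
        ; down     = λ {s} {t} {i} {j} s<t j≤i → Bool.¬-not λ adj →
            ℕ.<⇒≱ (Equivalence.to (adjacent {s} {t} (Fin.combine-monoˡ-< i j s<t)) adj) j≤i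
        }
        where
        v : Fin (suc m) → Fin K → Fin n
        v s i = position (combine s i) (proj₁ (hits (combine s i)))

        letter-v : ∀ s i → letter (v s i) ≡ step i
        letter-v s i = trans (sym (encode-injective (proj₂ (hits (combine s i)))))
                             (cong (step ∘ proj₂) (Fin.remQuot-combine s i))

        earlier : ∀ {s t : Fin (suc m)} {i j : Fin K} → s Fin.≤ t → i Fin.< j → combine s i Fin.< combine t j
        earlier {s} {t} {i} {j} s≤t i<j with Fin.<-cmp s t
        ... | tri< s<t _ _  = Fin.combine-monoˡ-< i j s<t
        ... | tri≈ _ refl _ = subst₂ _<_ (sym (Fin.toℕ-combine s i)) (sym (Fin.toℕ-combine s j))
                                (ℕ.+-monoʳ-< (K * toℕ s) i<j)
        ... | tri> _ _ t<s  = contradiction s≤t (ℕ.<⇒≱ t<s)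

        adjacent : ∀ {s t i j} → combine s i Fin.< combine t j → Adjacent G (v s i) (v t j) ⇔ i Fin.< j
        adjacent {s} {t} {i} {j} lt = ∈-below ⇔-∘ subst₂ (λ c p → Adjacent G (v s i) (v t j) ⇔ c ∈ p)
          (cong proj₁ (letter-v s i)) (cong proj₂ (letter-v t j)) (proj₂ G∈𝔾 _ _ (position-mono {combine s i} {combine t j} lt))

        disjoint : ∀ {s t i j} → s ≢ t → v s i ≢ v t j
        disjoint {s} {t} {i} {j} s≢t eq with Fin.<-cmp s t
        ... | tri< s<t _ _ = Fin.<⇒≢ (position-mono {combine s i} {combine t j} (Fin.combine-monoˡ-< i j s<t)) eq
        ... | tri≈ _ s≡t _ = s≢t s≡t
        ... | tri> _ _ t<s = Fin.<⇒≢ (position-mono {combine t j} {combine s i} (Fin.combine-monoˡ-< j i t<s)) (sym eq)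

    abstract
      -- Otherwise every block contains its target and `G` has a staircase, while the isomorphism to
      -- a `k`-rainbow graph gives it a layout.
      missing : ∀ {G : Graph n} ((G∈𝔾 , _) : IsoToLower k G) →
                ∃ λ b → Avoiding b (spelled {G} G∈𝔾)
      missing {G} (G∈𝔾 , H , H∈𝔾 , G≅H) with Fin.any? (avoids? {G} G∈𝔾)
      ... | yes found = found
      ... | no  none  = contradiction (layout {G = G} {H} H∈𝔾 G≅H) (¬staircase-layout many (staircase {G} G∈𝔾 hits))
        where
        hits : ∀ b → ∃ λ r → target b ≡ spelled {G} G∈𝔾 (position b r)
        hits b with Fin.¬∀⟶∃¬ q _ (λ r → ¬? (target b Fin.≟ spelled {G} G∈𝔾 (position b r))) (λ av → none (b , av))
        ... | r , ¬¬eq = r , decidable-stable (target b Fin.≟ _) ¬¬eq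

    block-code : ∀ b w → Avoiding b w → Fin (d ^ q * suc d ^ (n ∸ q))
    block-code b = code q (offset b) (block-fits b) (target b)

    total : ∀ {G : Graph n} → IsoToLower k G → Fin (blocks * (d ^ q * suc d ^ (n ∸ q)))
    total {G} low = combine (proj₁ (missing {G} low))
      (block-code (proj₁ (missing {G} low)) (spelled {G} (proj₁ low)) (proj₂ (missing {G} low)))

    block-code-injective : ∀ b b′ {w w′} (av : Avoiding b w) (av′ : Avoiding b′ w′) → b ≡ b′ →
                           block-code b w av ≡ block-code b′ w′ av′ → w ≗ w′
    block-code-injective b .b av av′ refl = code-injective q (offset b) (block-fits b) (target b) av av′

    -- Equal codes name the same block, hence the same word avoiding its target there. The word is
    -- the rainbow sequence, and that determines the graph.
    total-injective : ∀ {G H : Graph n} (g : IsoToLower k G) (h : IsoToLower k H) →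
                      total {G} g ≡ total {H} h → G ≡ H
    total-injective {G} {H} g h eq
      with b≡ , c≡ ← Fin.combine-injective (proj₁ (missing {G} g)) _ (proj₁ (missing {H} h)) _ eq
      = associated-unique {G = G} {H} (proj₂ (proj₁ g)) (proj₂ (proj₁ h)) (cong proj₁ ∘ same) (cong proj₂ ∘ same)
      where
      same : letter {G} (proj₁ g) ≗ letter {H} (proj₁ h)
      same x = encode-injective (block-code-injective (proj₁ (missing {G} g)) (proj₁ (missing {H} h))
        (proj₂ (missing {G} g)) (proj₂ (missing {H} h)) b≡ c≡ x)

  ∣isoToLower∣≤ : ∣ isoToLower? k {n} ∣ ≤ suc m * suc k * (d ^ q * suc d ^ (n ∸ q))
  ∣isoToLower∣≤ = ∣∣-≤ (isoToLower? k) (λ {G} → total {G}) (λ {G} {H} → total-injective {G} {H})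

-- Arithmetic of the bound

8*2^ : ∀ k c → 2 ^ (3 * suc k + c) ≡ 8 * 2 ^ (3 * k + c)
8*2^ k c = trans (cong (λ e → 2 ^ (e + c)) (ℕ.*-suc 3 k)) (thrice (2 ^ (3 * k + c)))
  where
  thrice : ∀ x → 2 * (2 * (2 * x)) ≡ 8 * x
  thrice = solve-∀

-- The polynomials p in the next two proofs satisfy p(k + 1) ≤ 8 p(k) coefficientwise.
blocks≤ : ∀ k → (2 + suc k * suc k * k) * suc k ≤ 2 ^ (3 * k + 3)
blocks≤ zero    = ℕ.m≤m+n 2 6
blocks≤ (suc k) = begin
  p (suc k)                ≤⟨ ℕ.m≤m+n _ _ ⟩
  p (suc k) + (7 * (k * k * k * k) + 17 * (k * k * k) + 6 * (k * k) + 2 * k + 4) ≡⟨ identity k ⟩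
  8 * p k                  ≤⟨ ℕ.*-monoʳ-≤ 8 (blocks≤ k) ⟩
  8 * 2 ^ (3 * k + 3)      ≡⟨ 8*2^ k 3 ⟨
  2 ^ (3 * suc k + 3)      ∎
  where
  open ℕ.≤-Reasoning

  p : ℕ → ℕ
  p k = (2 + suc k * suc k * k) * suc k

  identity : ∀ k → (2 + suc (suc k) * suc (suc k) * suc k) * suc (suc k)
                     + (7 * (k * k * k * k) + 17 * (k * k * k) + 6 * (k * k) + 2 * k + 4)
                   ≡ 8 * ((2 + suc k * suc k * k) * suc k)
  identity = solve-∀

exponent≤ : ∀ k → suc (3 * k + 3) + (suc k + suc k) * (suc k + suc k) ≤ 2 ^ (3 * k + 5)
exponent≤ zero    = ℕ.m≤m+n 8 24
exponent≤ (suc k) = begin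
  p (suc k)                ≤⟨ ℕ.m≤m+n _ _ ⟩
  p (suc k) + (28 * (k * k) + 69 * k + 41)     ≡⟨ identity k ⟩
  8 * p k                  ≤⟨ ℕ.*-monoʳ-≤ 8 (exponent≤ k) ⟩
  8 * 2 ^ (3 * k + 5)      ≡⟨ 8*2^ k 5 ⟨
  2 ^ (3 * suc k + 5)      ∎
  where
  open ℕ.≤-Reasoning

  p : ℕ → ℕ
  p k = suc (3 * k + 3) + (suc k + suc k) * (suc k + suc k)

  identity : ∀ k → suc (3 * suc k + 3) + (suc (suc k) + suc (suc k)) * (suc (suc k) + suc (suc k)) + (28 * (k * k) + 69 * k + 41)
                   ≡ 8 * (suc (3 * k + 3) + (suc k + suc k) * (suc k + suc k))
  identity = solve-∀

^-distribʳ-* : ∀ m n o → (m * n) ^ o ≡ m ^ o * n ^ o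
^-distribʳ-* m n zero    = refl
^-distribʳ-* m n (suc o) = trans (cong (m * n *_) (^-distribʳ-* m n o)) (interchange m n (m ^ o) (n ^ o))
  where
  interchange : ∀ a b c d → a * b * (c * d) ≡ a * c * (b * d)
  interchange = solve-∀

n<2^n : ∀ n → n < 2 ^ n
n<2^n zero    = s≤s z≤n
n<2^n (suc n) = ℕ.+-mono-≤ (ℕ.m^n>0 2 n) (ℕ.≤-trans (n<2^n n) (ℕ.m≤m+n (2 ^ n) 0))

letters≤ : ∀ k → letters k ≤ 2 ^ (suc k + suc k)
letters≤ k = begin
  suc k * 2 ^ suc k       ≤⟨ ℕ.*-monoˡ-≤ (2 ^ suc k) (ℕ.<⇒≤ (n<2^n (suc k))) ⟩
  2 ^ suc k * 2 ^ suc k   ≡⟨ ℕ.^-distribˡ-+-* 2 (suc k) (suc k) ⟨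
  2 ^ (suc k + suc k)     ∎
  where open ℕ.≤-Reasoning

1<letters : ∀ k → 1 < letters k
1<letters k = ℕ.≤-trans (ℕ.*-monoʳ-≤ 2 (ℕ.m^n>0 2 k)) (ℕ.m≤m+n (2 ^ suc k) (k * 2 ^ suc k))

-- The constant has to absorb the choice among at most `N` blocks, a factor 2 from rounding `n / N`
-- down, and `D ^ (2K)` from the letters fixed at both ends. Since `D ≤ 2 ^ (2K)`, the exponents of
-- 2 add up to `(3k + 4) + (2K)²`.
overhead≤ : ∀ k → 2 ^ (3 * k + 3) * (2 * letters k ^ (suc k + suc k)) ≤ 2 ^ 2 ^ (3 * k + 5)
overhead≤ k = begin
  2 ^ (3 * k + 3) * (2 * letters k ^ K₂)     ≤⟨ ℕ.*-monoʳ-≤ (2 ^ (3 * k + 3)) (ℕ.*-monoʳ-≤ 2 (ℕ.^-monoˡ-≤ K₂ (letters≤ k))) ⟩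
  2 ^ (3 * k + 3) * (2 * (2 ^ K₂) ^ K₂)      ≡⟨ cong (λ x → 2 ^ (3 * k + 3) * (2 * x)) (ℕ.^-*-assoc 2 K₂ K₂) ⟩
  2 ^ (3 * k + 3) * (2 * 2 ^ (K₂ * K₂))      ≡⟨ regroup (2 ^ (3 * k + 3)) (2 ^ (K₂ * K₂)) ⟩
  2 ^ suc (3 * k + 3) * 2 ^ (K₂ * K₂)        ≡⟨ ℕ.^-distribˡ-+-* 2 (suc (3 * k + 3)) (K₂ * K₂) ⟨
  2 ^ (suc (3 * k + 3) + K₂ * K₂)            ≤⟨ ℕ.^-monoʳ-≤ 2 (exponent≤ k) ⟩
  2 ^ 2 ^ (3 * k + 5)                        ∎
  where
  open ℕ.≤-Reasoning

  K₂ : ℕ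
  K₂ = suc k + suc k

  regroup : ∀ x y → x * (2 * y) ≡ 2 * x * y
  regroup = solve-∀

-- The estimate A/B ≤ β^(n/N) · C, with β = d / (d + 1), raised to the power N and cleared
-- of denominators; replacing n/N by ⌊n/N⌋ costs at most a factor β⁻¹ ≤ 2.
power-bound : ∀ {A B C d s N L n} .{{_ : NonZero N}} → 1 ≤ d → s ≤ n → L ≤ N →
              A ≤ L * (d ^ (n / N) * suc d ^ (n ∸ n / N)) →
              suc d ^ (n ∸ s) ≤ B →
              N * (2 * suc d ^ s) ≤ C →
              A ^ N * suc d ^ n ≤ d ^ n * C ^ N * B ^ N
power-bound {A} {B} {C} {d} {s} {N} {L} {n} 1≤d s≤n L≤N A≤ ≤B ≤C = begin
  A ^ N * D ^ n                                   ≤⟨ ℕ.*-monoˡ-≤ (D ^ n) (ℕ.^-monoˡ-≤ N A≤) ⟩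
  (L * (d ^ q * D ^ (n ∸ q))) ^ N * D ^ n         ≡⟨ cong ((L * (d ^ q * D ^ (n ∸ q))) ^ N *_) (split D) ⟩
  (L * (d ^ q * D ^ (n ∸ q))) ^ N * (D ^ r * (D ^ q) ^ N)
    -- The cost of rounding down: as `r < N` and `D ≤ 2 * d`, passing from `D ^ r` to `d ^ r` costs
    -- at most `2 ^ N`, which is a factor 2 under the outer power.
    ≤⟨ ℕ.*-monoʳ-≤ ((L * (d ^ q * D ^ (n ∸ q))) ^ N) (ℕ.*-monoˡ-≤ ((D ^ q) ^ N) D^r≤) ⟩
  (L * (d ^ q * D ^ (n ∸ q))) ^ N * (2 ^ N * d ^ r * (D ^ q) ^ N)
    ≡⟨ regroup₁ ((L * (d ^ q * D ^ (n ∸ q))) ^ N) (2 ^ N) (d ^ r) ((D ^ q) ^ N) ⟩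
  (L * (d ^ q * D ^ (n ∸ q))) ^ N * ((2 ^ N) * (D ^ q) ^ N) * d ^ r
    ≡⟨ cong (λ x → (L * (d ^ q * D ^ (n ∸ q))) ^ N * x * d ^ r) (^-distribʳ-* 2 (D ^ q) N) ⟨
  (L * (d ^ q * D ^ (n ∸ q))) ^ N * (2 * D ^ q) ^ N * d ^ r
    ≡⟨ cong (_* d ^ r) (^-distribʳ-* (L * (d ^ q * D ^ (n ∸ q))) (2 * D ^ q) N) ⟨
  (L * (d ^ q * D ^ (n ∸ q)) * (2 * D ^ q)) ^ N * d ^ r
    ≡⟨ cong (λ x → x ^ N * d ^ r) (regroup₂ L (d ^ q) (D ^ (n ∸ q)) (D ^ q)) ⟩
  (d ^ q * (L * (2 * (D ^ (n ∸ q) * D ^ q)))) ^ N * d ^ r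
    ≡⟨ cong (λ x → (d ^ q * (L * (2 * x))) ^ N * d ^ r) (rejoin q≤n) ⟩
  (d ^ q * (L * (2 * D ^ n))) ^ N * d ^ r
    ≤⟨ ℕ.*-monoˡ-≤ (d ^ r) (ℕ.^-monoˡ-≤ N (ℕ.*-monoʳ-≤ (d ^ q) L2D^n≤)) ⟩
  (d ^ q * (C * B)) ^ N * d ^ r
    ≡⟨ cong (_* d ^ r) (trans (^-distribʳ-* (d ^ q) (C * B) N) (cong ((d ^ q) ^ N *_) (^-distribʳ-* C B N))) ⟩
  (d ^ q) ^ N * (C ^ N * B ^ N) * d ^ r           ≡⟨ regroup₃ ((d ^ q) ^ N) (C ^ N) (B ^ N) (d ^ r) ⟩
  d ^ r * (d ^ q) ^ N * C ^ N * B ^ N             ≡⟨ cong (λ x → x * C ^ N * B ^ N) (split d) ⟨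
  d ^ n * C ^ N * B ^ N                           ∎
  where
  open ℕ.≤-Reasoning

  D q r : ℕ
  D = suc d
  q = n / N
  r = n ℕ.% N

  q≤n : q ≤ n
  q≤n = ℕ.≤-trans (ℕ.m≤m*n q N) (m/n*n≤m n N)

  split : ∀ x → x ^ n ≡ x ^ r * (x ^ q) ^ N
  split x = trans (cong (x ^_) (m≡m%n+[m/n]*n n N))
    (trans (ℕ.^-distribˡ-+-* x r (q * N)) (cong (x ^ r *_) (sym (ℕ.^-*-assoc x q N))))

  rejoin : ∀ {i} → i ≤ n → D ^ (n ∸ i) * D ^ i ≡ D ^ n
  rejoin {i} i≤n = trans (sym (ℕ.^-distribˡ-+-* D (n ∸ i) i)) (cong (D ^_) (ℕ.m∸n+n≡m i≤n))

  D≤2d : D ≤ 2 * d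
  D≤2d = begin
    suc d ≤⟨ ℕ.+-monoˡ-≤ d 1≤d ⟩
    d + d ≡⟨ cong (_+_ d) (ℕ.+-identityʳ d) ⟨
    2 * d ∎

  D^r≤ : D ^ r ≤ 2 ^ N * d ^ r
  D^r≤ = begin
    D ^ r         ≤⟨ ℕ.^-monoˡ-≤ r D≤2d ⟩
    (2 * d) ^ r   ≡⟨ ^-distribʳ-* 2 d r ⟩
    2 ^ r * d ^ r ≤⟨ ℕ.*-monoˡ-≤ (d ^ r) (ℕ.^-monoʳ-≤ 2 (ℕ.<⇒≤ (m%n<n n N))) ⟩
    2 ^ N * d ^ r ∎

  -- Splitting `D ^ n` at `s` leaves `D ^ (n ∸ s)` to be bounded by `B`, while `D ^ s` goes into the
  -- constant `C`.
  L2D^n≤ : L * (2 * D ^ n) ≤ C * B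
  L2D^n≤ = begin
    L * (2 * D ^ n)                 ≤⟨ ℕ.*-monoˡ-≤ (2 * D ^ n) L≤N ⟩
    N * (2 * D ^ n)                 ≡⟨ cong (λ x → N * (2 * x)) (rejoin s≤n) ⟨
    N * (2 * (D ^ (n ∸ s) * D ^ s)) ≡⟨ regroup₄ N (D ^ (n ∸ s)) (D ^ s) ⟩
    N * (2 * D ^ s) * D ^ (n ∸ s)   ≤⟨ ℕ.*-mono-≤ ≤C ≤B ⟩
    C * B                           ∎
    where
    regroup₄ : ∀ a b c → a * (2 * (b * c)) ≡ a * (2 * c) * b
    regroup₄ = solve-∀

  regroup₁ : ∀ a b c e → a * (b * c * e) ≡ a * (b * e) * c
  regroup₁ = solve-∀

  regroup₂ : ∀ a b c e → a * (b * c) * (2 * e) ≡ b * (a * (2 * (c * e)))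
  regroup₂ = solve-∀

  regroup₃ : ∀ a b c e → a * (b * c) * e ≡ e * a * b * c
  regroup₃ = solve-∀

-- Rational powers and cuts

toℚᵘ-/ : ∀ m n → ℚ.toℚᵘ (+ m ℚ./ suc n) ℚᵘ.≃ ℚᵘ.mkℚᵘ (+ m) n
toℚᵘ-/ m n = ℚ.toℚᵘ-fromℚᵘ (ℚᵘ.mkℚᵘ (+ m) n)

/-*-cancel : ∀ m n .{{_ : NonZero n}} → (+ m ℚ./ n) ℚ.* fromℕ n ≡ fromℕ m
/-*-cancel m (suc n) = ℚ.toℚᵘ-injective (begin-equality
  ℚ.toℚᵘ ((+ m ℚ./ suc n) ℚ.* fromℕ (suc n))              ≃⟨ ℚ.toℚᵘ-homo-* (+ m ℚ./ suc n) (fromℕ (suc n)) ⟩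
  ℚ.toℚᵘ (+ m ℚ./ suc n) ℚᵘ.* ℚ.toℚᵘ (fromℕ (suc n))      ≃⟨ ℚᵘ.*-cong (toℚᵘ-/ m n) (toℚᵘ-/ (suc n) 0) ⟩
  ℚᵘ.mkℚᵘ (+ m) n ℚᵘ.* ℚᵘ.mkℚᵘ (+ suc n) 0                ≃⟨ ℚᵘ.*≡* (trans (ℤ.*-identityʳ (+ m ℤ.* + suc n)) (cong (λ x → + m ℤ.* + x) (sym (ℕ.*-identityʳ (suc n))))) ⟩
  ℚᵘ.mkℚᵘ (+ m) 0                                         ≃⟨ toℚᵘ-/ m 0 ⟨
  ℚ.toℚᵘ (fromℕ m)                                        ∎)
  where open ℚᵘ.≤-Reasoning

fromℕ-* : ∀ m n → fromℕ (m ℕ.* n) ≡ fromℕ m ℚ.* fromℕ n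
fromℕ-* m n = ℚ.toℚᵘ-injective (begin-equality
  ℚ.toℚᵘ (fromℕ (m ℕ.* n))                      ≃⟨ toℚᵘ-/ (m ℕ.* n) 0 ⟩
  ℚᵘ.mkℚᵘ (+ (m ℕ.* n)) 0                       ≃⟨ ℚᵘ.*≡* (cong (ℤ._* + 1) (ℤ.pos-* m n)) ⟩
  ℚᵘ.mkℚᵘ (+ m) 0 ℚᵘ.* ℚᵘ.mkℚᵘ (+ n) 0          ≃⟨ ℚᵘ.*-cong (toℚᵘ-/ m 0) (toℚᵘ-/ n 0) ⟨
  ℚ.toℚᵘ (fromℕ m) ℚᵘ.* ℚ.toℚᵘ (fromℕ n)        ≃⟨ ℚ.toℚᵘ-homo-* (fromℕ m) (fromℕ n) ⟨
  ℚ.toℚᵘ (fromℕ m ℚ.* fromℕ n)                  ∎)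
  where open ℚᵘ.≤-Reasoning

fromℕ-suc : ∀ n → fromℕ (suc n) ≡ 1ℚ ℚ.+ fromℕ n
fromℕ-suc n = ℚ.toℚᵘ-injective (begin-equality
  ℚ.toℚᵘ (fromℕ (suc n))                        ≃⟨ toℚᵘ-/ (suc n) 0 ⟩
  ℚᵘ.mkℚᵘ (+ suc n) 0                           ≃⟨ ℚᵘ.*≡* (cong (ℤ._* + 1) (cong (ℤ._+_ (+ 1)) (sym (ℤ.*-identityʳ (+ n))))) ⟩
  ℚᵘ.1ℚᵘ ℚᵘ.+ ℚᵘ.mkℚᵘ (+ n) 0                   ≃⟨ ℚᵘ.+-congʳ ℚᵘ.1ℚᵘ (toℚᵘ-/ n 0) ⟨
  ℚᵘ.1ℚᵘ ℚᵘ.+ ℚ.toℚᵘ (fromℕ n)                  ≃⟨ ℚ.toℚᵘ-homo-+ 1ℚ (fromℕ n) ⟨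
  ℚ.toℚᵘ (1ℚ ℚ.+ fromℕ n)                       ∎)
  where open ℚᵘ.≤-Reasoning

fromℕ-^ : ∀ m n → fromℕ (m ℕ.^ n) ≡ fromℕ m ^ℚ n
fromℕ-^ m zero    = refl
fromℕ-^ m (suc n) = trans (fromℕ-* m (m ℕ.^ n)) (cong (fromℕ m ℚ.*_) (fromℕ-^ m n))

fromℕ-mono-≤ : ∀ {m n} → m ℕ.≤ n → fromℕ m ℚ.≤ fromℕ n
fromℕ-mono-≤ {m} {n} m≤n = ℚ.toℚᵘ-cancel-≤ (begin
  ℚ.toℚᵘ (fromℕ m)   ≃⟨ toℚᵘ-/ m 0 ⟩
  ℚᵘ.mkℚᵘ (+ m) 0    ≤⟨ ℚᵘ.*≤* (ℤ.*-monoʳ-≤-nonNeg (+ 1) (ℤ.+≤+ m≤n)) ⟩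
  ℚᵘ.mkℚᵘ (+ n) 0    ≃⟨ toℚᵘ-/ n 0 ⟨
  ℚ.toℚᵘ (fromℕ n)   ∎)
  where open ℚᵘ.≤-Reasoning

0≤fromℕ : ∀ n → 0ℚ ℚ.≤ fromℕ n
0≤fromℕ n = fromℕ-mono-≤ {0} {n} ℕ.z≤n

fromℕ-positive : ∀ n .{{_ : NonZero n}} → ℚ.Positive (fromℕ n)
fromℕ-positive n = ℚ.positive (ℚ.<-≤-trans (ℚ.positive⁻¹ 1ℚ) (fromℕ-mono-≤ {1} {n} (ℕ.>-nonZero⁻¹ n)))

*-mono-≤ : ∀ {p q r s} → 0ℚ ℚ.≤ p → 0ℚ ℚ.≤ s → p ℚ.≤ q → r ℚ.≤ s → p ℚ.* r ℚ.≤ q ℚ.* s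
*-mono-≤ {p} {q} {r} {s} 0≤p 0≤s p≤q r≤s = ℚ.≤-trans
  (ℚ.*-monoˡ-≤-nonNeg p {{ℚ.nonNegative 0≤p}} r≤s) (ℚ.*-monoʳ-≤-nonNeg s {{ℚ.nonNegative 0≤s}} p≤q)

*-mono-< : ∀ {p q r s} → 0ℚ ℚ.< p → 0ℚ ℚ.< s → p ℚ.< q → r ℚ.< s → p ℚ.* r ℚ.< q ℚ.* s
*-mono-< {p} {q} {r} {s} 0<p 0<s p<q r<s = ℚ.<-trans
  (ℚ.*-monoʳ-<-pos p {{ℚ.positive 0<p}} r<s) (ℚ.*-monoˡ-<-pos s {{ℚ.positive 0<s}} p<q)

0<* : ∀ {p q} → 0ℚ ℚ.< p → 0ℚ ℚ.< q → 0ℚ ℚ.< p ℚ.* q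
0<* {p} {q} 0<p 0<q = ℚ.positive⁻¹ (p ℚ.* q) {{ℚ.pos*pos⇒pos p {{ℚ.positive 0<p}} q {{ℚ.positive 0<q}}}}

0<^ : ∀ {p} n → 0ℚ ℚ.< p → 0ℚ ℚ.< p ^ℚ n
0<^ zero    _   = ℚ.positive⁻¹ 1ℚ
0<^ (suc n) 0<p = 0<* 0<p (0<^ n 0<p)

^-monoˡ-≤ : ∀ {p q} n → 0ℚ ℚ.< p → p ℚ.≤ q → p ^ℚ n ℚ.≤ q ^ℚ n
^-monoˡ-≤ zero    _   _   = ℚ.≤-refl
^-monoˡ-≤ (suc n) 0<p p≤q = *-mono-≤ (ℚ.<⇒≤ 0<p) (ℚ.<⇒≤ (0<^ n (ℚ.<-≤-trans 0<p p≤q))) p≤q (^-monoˡ-≤ n 0<p p≤q)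

1≤^ : ∀ {p} n → 1ℚ ℚ.< p → 1ℚ ℚ.≤ p ^ℚ n
1≤^ zero    1<p = ℚ.≤-refl
1≤^ (suc n) 1<p = *-mono-≤ (ℚ.<⇒≤ (ℚ.positive⁻¹ 1ℚ)) (ℚ.≤-trans (ℚ.<⇒≤ (ℚ.positive⁻¹ 1ℚ)) (1≤^ n 1<p)) (ℚ.<⇒≤ 1<p) (1≤^ n 1<p)

1<^ : ∀ {p} n .{{_ : NonZero n}} → 1ℚ ℚ.< p → 1ℚ ℚ.< p ^ℚ n
1<^ {p} (suc n) 1<p = ℚ.<-≤-trans 1<p (subst (ℚ._≤ p ^ℚ suc n) (ℚ.*-identityʳ p)
  (*-mono-≤ 0≤p (ℚ.≤-trans (ℚ.<⇒≤ (ℚ.positive⁻¹ 1ℚ)) (1≤^ n 1<p)) ℚ.≤-refl (1≤^ n 1<p)))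
  where
  0≤p : 0ℚ ℚ.≤ p
  0≤p = ℚ.<⇒≤ (ℚ.<-trans (ℚ.positive⁻¹ 1ℚ) 1<p)

-- Upper bounds of products and of powers of roots

-- The maximum over the four endpoint products dominates the product of the two upper endpoints.
Upper-* : ∀ {x y p} → Upper (x *ᶜ y) p → ∃₂ λ b d → Upper x b × Upper y d × b ℚ.* d ℚ.< p
Upper-* (a , b , c , d , (_ , x<b , _ , y<d) , max<p) =
  b , d , x<b , y<d , ℚ.≤-<-trans
    (ℚ.≤-trans (ℚ.p≤q⊔p (b ℚ.* c) (b ℚ.* d)) (ℚ.p≤q⊔p (a ℚ.* c ℚ.⊔ a ℚ.* d) (b ℚ.* c ℚ.⊔ b ℚ.* d))) max<p

module _ {N : ℕ} .{{_ : NonZero N}} {q : ℚ} .{{_ : ℚ.NonNegative q}} (0<q : 0ℚ ℚ.< q) where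

  -- Turns an upper bound of the real `q^(n/N)` into an inequality between rationals. In the
  -- induction, bounds for the factors multiply and `N`-th powers respect products.
  Upper-root^ : ∀ n {b} → Upper (root N q ^ᶜ n) b → 0ℚ ℚ.< b × q ^ℚ n ℚ.< b ^ℚ N
  Upper-root^ zero    1<b = ℚ.<-trans (ℚ.positive⁻¹ 1ℚ) 1<b , 1<^ N 1<b
  Upper-root^ (suc n) {b} b∈ with s , t , (0<s , q<s^N) , t∈ , st<b ← Upper-* {root N q} {root N q ^ᶜ n} b∈
                             with 0<t , q^n<t^N ← Upper-root^ n t∈ =
    ℚ.<-trans (0<* 0<s 0<t) st<b , (begin-strict
      q ℚ.* q ^ℚ n           <⟨ *-mono-< 0<q (0<^ N 0<t) q<s^N q^n<t^N ⟩
      s ^ℚ N ℚ.* t ^ℚ N      ≡⟨ ^ℚ-distrib-* s t N ⟨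
      (s ℚ.* t) ^ℚ N         ≤⟨ ^-monoˡ-≤ N (0<* 0<s 0<t) (ℚ.<⇒≤ st<b) ⟩
      b ^ℚ N                 ∎)
    where open ℚ.≤-Reasoning

-- A counterexample would give rationals with `b * e < A / B`, `q ^ n < b ^ N` and `C < e`. Then
-- `b * C * B ≤ A`; taking `N`-th powers, multiplying by `D ^ n` and using `q * D = d` contradicts
-- the integer inequality.
fraction-≤ᶜ-root : ∀ {N n A B C D d} {q} .{{_ : NonZero N}} .{{_ : NonZero B}} .{{_ : NonZero C}} .{{_ : NonZero D}}
                   .{{_ : ℚ.NonNegative q}} → 0ℚ ℚ.< q → q ℚ.* fromℕ D ≡ fromℕ d →
                   A ℕ.^ N ℕ.* D ℕ.^ n ℕ.≤ d ℕ.^ n ℕ.* C ℕ.^ N ℕ.* B ℕ.^ N →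
                   fromℚ (+ A ℚ./ B) ≤ᶜ (root N q ^ᶜ n) *ᶜ fromℚ (fromℕ C)
fraction-≤ᶜ-root {N} {n} {A} {B} {C} {D} {d} {q} 0<q qD≡d bound (r , r∈ , r<A/B)
  with b , e , b∈ , C<e , be<r ← Upper-* {root N q ^ᶜ n} {fromℚ (fromℕ C)} r∈
  with 0<b , q^n<b^N ← Upper-root^ 0<q n b∈
  = ℚ.<-irrefl refl (begin-strict
      fromℕ (d ℕ.^ n ℕ.* C ℕ.^ N ℕ.* B ℕ.^ N)  ≡⟨ fromℕ-*-^ ⟩
      q ^ℚ n ℚ.* (C^N*B^N ℚ.* D^n)             <⟨ ℚ.*-monoˡ-<-pos _ {{ℚ.positive (0<* (0<* (0<^ N 0<C) (0<^ N 0<B)) (0<^ n 0<D))}} q^n<b^N ⟩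
      b ^ℚ N ℚ.* (C^N*B^N ℚ.* D^n)             ≡⟨ ℚ.*-assoc (b ^ℚ N) C^N*B^N D^n ⟨
      b ^ℚ N ℚ.* C^N*B^N ℚ.* D^n               ≡⟨ cong (ℚ._* D^n) (trans (cong (b ^ℚ N ℚ.*_) (sym (^ℚ-distrib-* (fromℕ C) (fromℕ B) N)))
                                                                       (sym (^ℚ-distrib-* b (fromℕ C ℚ.* fromℕ B) N))) ⟩
      (b ℚ.* (fromℕ C ℚ.* fromℕ B)) ^ℚ N ℚ.* D^n ≤⟨ ℚ.*-monoʳ-≤-nonNeg D^n {{ℚ.nonNegative (ℚ.<⇒≤ (0<^ n 0<D))}} (^-monoˡ-≤ N (0<* 0<b (0<* 0<C 0<B)) bCB≤A) ⟩
      fromℕ A ^ℚ N ℚ.* D^n                     ≡⟨ trans (fromℕ-* (A ℕ.^ N) (D ℕ.^ n)) (cong₂ ℚ._*_ (fromℕ-^ A N) (fromℕ-^ D n)) ⟨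
      fromℕ (A ℕ.^ N ℕ.* D ℕ.^ n)              ≤⟨ fromℕ-mono-≤ bound ⟩
      fromℕ (d ℕ.^ n ℕ.* C ℕ.^ N ℕ.* B ℕ.^ N)  ∎)
  where
  open ℚ.≤-Reasoning

  C^N*B^N D^n : ℚ
  C^N*B^N = fromℕ C ^ℚ N ℚ.* fromℕ B ^ℚ N
  D^n     = fromℕ D ^ℚ n

  0<B : 0ℚ ℚ.< fromℕ B
  0<B = ℚ.positive⁻¹ _ {{fromℕ-positive B}}

  0<C : 0ℚ ℚ.< fromℕ C
  0<C = ℚ.positive⁻¹ _ {{fromℕ-positive C}}

  0<D : 0ℚ ℚ.< fromℕ D
  0<D = ℚ.positive⁻¹ _ {{fromℕ-positive D}}

  fromℕ-*-^ : fromℕ (d ℕ.^ n ℕ.* C ℕ.^ N ℕ.* B ℕ.^ N) ≡ q ^ℚ n ℚ.* (C^N*B^N ℚ.* D^n)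
  fromℕ-*-^ = begin-equality
    fromℕ (d ℕ.^ n ℕ.* C ℕ.^ N ℕ.* B ℕ.^ N)                ≡⟨ fromℕ-* (d ℕ.^ n ℕ.* C ℕ.^ N) (B ℕ.^ N) ⟩
    fromℕ (d ℕ.^ n ℕ.* C ℕ.^ N) ℚ.* fromℕ (B ℕ.^ N)        ≡⟨ cong₂ ℚ._*_ (trans (fromℕ-* (d ℕ.^ n) (C ℕ.^ N))
                                                                (cong₂ ℚ._*_ (fromℕ-^ d n) (fromℕ-^ C N))) (fromℕ-^ B N) ⟩
    fromℕ d ^ℚ n ℚ.* fromℕ C ^ℚ N ℚ.* fromℕ B ^ℚ N         ≡⟨ cong (λ x → x ℚ.* fromℕ C ^ℚ N ℚ.* fromℕ B ^ℚ N)
                                                                (trans (cong (_^ℚ n) (sym qD≡d)) (^ℚ-distrib-* q (fromℕ D) n)) ⟩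
    q ^ℚ n ℚ.* D^n ℚ.* fromℕ C ^ℚ N ℚ.* fromℕ B ^ℚ N       ≡⟨ regroup (q ^ℚ n) D^n (fromℕ C ^ℚ N) (fromℕ B ^ℚ N) ⟩
    q ^ℚ n ℚ.* (C^N*B^N ℚ.* D^n)                           ∎
    where
    regroup : ∀ a b c e → a ℚ.* b ℚ.* c ℚ.* e ≡ a ℚ.* (c ℚ.* e ℚ.* b)
    regroup = solve 4 (λ a b c e → a :* b :* c :* e := a :* (c :* e :* b)) refl
      where open +-*-Solver

  bCB≤A : b ℚ.* (fromℕ C ℚ.* fromℕ B) ℚ.≤ fromℕ A
  bCB≤A = begin
    b ℚ.* (fromℕ C ℚ.* fromℕ B)   ≡⟨ ℚ.*-assoc b (fromℕ C) (fromℕ B) ⟨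
    b ℚ.* fromℕ C ℚ.* fromℕ B     ≤⟨ ℚ.*-monoʳ-≤-nonNeg (fromℕ B) {{ℚ.nonNegative (0≤fromℕ B)}} bC≤A/B ⟩
    (+ A ℚ./ B) ℚ.* fromℕ B       ≡⟨ /-*-cancel A B ⟩
    fromℕ A                       ∎
    where
    bC≤A/B : b ℚ.* fromℕ C ℚ.≤ + A ℚ./ B
    bC≤A/B = ℚ.≤-trans (ℚ.*-monoˡ-≤-nonNeg b {{ℚ.nonNegative (ℚ.<⇒≤ 0<b)}} (ℚ.<⇒≤ C<e)) (ℚ.<⇒≤ (ℚ.<-trans be<r r<A/B))

-- The estimate for the quotient of the two counts

-- The identity `β = (D − 1) / D` with its denominator cleared, which is the form `fraction-≤ᶜ-root`
-- takes.
β*letters : ∀ k {d} → suc d ≡ letters k → β k ℚ.* fromℕ (suc d) ≡ fromℕ d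
β*letters k {d} eq = begin
  (1ℚ ℚ.- u) ℚ.* fromℕ (suc d)                           ≡⟨ ℚ.*-distribʳ-+ (fromℕ (suc d)) 1ℚ (ℚ.- u) ⟩
  1ℚ ℚ.* fromℕ (suc d) ℚ.+ (ℚ.- u) ℚ.* fromℕ (suc d)     ≡⟨ cong₂ ℚ._+_ (ℚ.*-identityˡ (fromℕ (suc d))) (sym (ℚ.neg-distribˡ-* u (fromℕ (suc d)))) ⟩
  fromℕ (suc d) ℚ.- u ℚ.* fromℕ (suc d)                  ≡⟨ cong₂ ℚ._-_ (fromℕ-suc d) (trans (cong (λ x → u ℚ.* fromℕ x) eq) (/-*-cancel 1 (letters k) {{types-nonZero k}})) ⟩
  1ℚ ℚ.+ fromℕ d ℚ.- 1ℚ                                  ≡⟨ cong (ℚ._- 1ℚ) (ℚ.+-comm 1ℚ (fromℕ d)) ⟩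
  fromℕ d ℚ.+ 1ℚ ℚ.- 1ℚ                                  ≡⟨ ℚ.+-assoc (fromℕ d) 1ℚ (ℚ.- 1ℚ) ⟩
  fromℕ d ℚ.+ (1ℚ ℚ.- 1ℚ)                                ≡⟨ cong (fromℕ d ℚ.+_) (ℚ.+-inverseʳ 1ℚ) ⟩
  fromℕ d ℚ.+ 0ℚ                                         ≡⟨ ℚ.+-identityʳ (fromℕ d) ⟩
  fromℕ d                                                ∎
  where
  open ≡-Reasoning
  u : ℚ
  u = (+ 1 ℚ./ letters k) {{types-nonZero k}}

ratio-bound : ∀ k {d n} → suc d ≡ letters k → 2 ^ (3 * k + 3) ≤ n →
              ∣ isoToLower? k {n} ∣ ^ 2 ^ (3 * k + 3) * suc d ^ n
                ≤ d ^ n * (2 ^ 2 ^ (3 * k + 5)) ^ 2 ^ (3 * k + 3) * ∣ 𝔾? (suc k) {n} ∣ ^ 2 ^ (3 * k + 3)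
ratio-bound k {d} {n} eq N≤n = power-bound
  {A = ∣ isoToLower? k {n} ∣} {B = ∣ 𝔾? (suc k) {n} ∣} {C = 2 ^ 2 ^ (3 * k + 5)}
  -- `s` counts the letters fixed at the two ends, and `L` is the length of the staircase word, one
  -- block per letter.
  {d = d} {s = K + K} {N = N} {L = (2 + K * K * k) * K} {n = n} {{N≢0}}
  (ℕ.s≤s⁻¹ (subst (2 ≤_) (sym eq) (1<letters k))) K+K≤n (blocks≤ k)
  -- The least `m` above the number `K * K * k` of shapes, so that `suc m * K` is `L`.
  (∣isoToLower∣≤ alphabet {m = suc (K * K * k)} {n = n} {q = q} ℕ.≤-refl
    (ℕ.≤-trans (ℕ.*-monoˡ-≤ q (blocks≤ k)) (subst (_≤ n) (ℕ.*-comm q N) (m/n*n≤m n N {{N≢0}}))))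
  (^≤∣𝔾∣ alphabet (n ∸ (K + K)) size≡)
  (subst (λ D → N * (2 * D ^ (K + K)) ≤ 2 ^ 2 ^ (3 * k + 5)) (sym eq) (overhead≤ k))
  where
  K N : ℕ
  K = suc k
  N = 2 ^ (3 * k + 3)

  N≢0 : NonZero N
  N≢0 = 2^-nonZero (3 * k + 3)

  q : ℕ
  q = (n / N) {{N≢0}}

  alphabet : Fin (suc d) ↔ Letter k
  alphabet = subst (λ D → Fin D ↔ Letter k) (sym eq) (letter↔ k)

  K+K≤n : K + K ≤ n
  K+K≤n = ℕ.≤-trans (subst (_≤ (2 + K * K * k) * K) (cong (_+_ K) (ℕ.+-identityʳ K)) (ℕ.*-monoˡ-≤ K (ℕ.m≤m+n 2 (K * K * k))))
                    (ℕ.≤-trans (blocks≤ k) N≤n)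

  size≡ : K + (n ∸ (K + K) + K) ≡ n
  size≡ = trans (ℕ.+-comm K _) (trans (ℕ.+-assoc (n ∸ (K + K)) K K) (ℕ.m∸n+n≡m K+K≤n))

isoToLower-ratio : ∀ k {d n} → suc d ≡ letters k → 2 ^ (3 * k + 3) ≤ n →
  fromℚ ((+ ∣ isoToLower? k {n} ∣ ℚ./ ∣ 𝔾? (suc k) {n} ∣) {{∣𝔾∣-nonZero k n}})
    ≤ᶜ (root (2 ^ (3 * k + 3)) {{2^-nonZero (3 * k + 3)}} (β k) {{β-nonNegative k}} ^ᶜ n)
         *ᶜ fromℚ (fromℕ (2 ^ (2 ^ (3 * k + 5))))
isoToLower-ratio k {d} {n} eq N≤n =
  fraction-≤ᶜ-root {n = n} {A = ∣ isoToLower? k {n} ∣} {B = ∣ 𝔾? (suc k) {n} ∣} {D = suc d} {d = d}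
    {{2^-nonZero (3 * k + 3)}} {{∣𝔾∣-nonZero k n}} {{2^-nonZero (2 ^ (3 * k + 5))}} {{_}} {{β-nonNegative k}}
    (ℚ.positive⁻¹ (β k) {{β-positive k}}) (β*letters k eq) (ratio-bound k eq N≤n)

theorem3p12 : (k n ℓ : ℕ) .{{_ : NonZero ℓ}} →
    n / ℓ ≥ 2 ^ (3 * k + 3) →
    fromℚ (fromℕ n) ≥ᶜ (ℚ.- fromℕ (2 ^ (4 * k + 7))) ÷ᶜ log₂ (β k) {{β-positive k}} →
    fromℚ ((+ ∣ isoToLower? k {n} ∣ ℚ./ ∣ 𝔾? (suc k) {n} ∣) {{∣𝔾∣-nonZero k n}})
    ≤ᶜ (root (2 ^ (3 * k + 3)) {{2^-nonZero (3 * k + 3)}} (β k) {{β-nonNegative k}} ^ᶜ n)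
    *ᶜ fromℚ (fromℕ (2 ^ (2 ^ (3 * k + 5))))
theorem3p12 k n ℓ n/ℓ≥N _ =
  -- Here `d` is `letters k` minus one, and `n` is at least `n / ℓ`, hence at least `N`.
  isoToLower-ratio k (ℕ.suc-pred (letters k) {{types-nonZero k}}) (ℕ.≤-trans n/ℓ≥N (m/n≤m n ℓ))
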